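{- For every integer $n \geq 15$, $\frac{3}{2}n-\frac{5}{2} \leq rsat(n,C_5) \leq 2n-6$.
   Context: All graphs are finite, simple and undirected. An edge-coloring of a graph $G$ is a function $\mathcal{C}:E(G)\to\mathbb{N}$; a (sub)graph is rainbow if all its edges have distinct colors. Given a graph $F$, an edge-colored graph $G$ is $F$-rainbow free if it contains no rainbow copy of $F$, and it is $F$-rainbow saturated if it is $F$-rainbow free but adding any nonedge of $G$ with any color on it creates a rainbow copy of $F$. The rainbow saturation number $rsat(n,F)$ is the minimum number of edges of a graph $G$ on $n$ vertices for which some edge-coloring makes $G$ $F$-rainbow saturated. $C_r$ denotes the cycle on $r$ vertices. -}

module Defs where

open import Data.Nat using (ℕ; zero; suc; _≡ᵇ_; _<ᵇ_)
open import Data.Bool using (Bool; true; false; _∨_; _∧_; if_then_else_)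
open import Data.Fin using (Fin; toℕ; _≟_)
open import Data.Fin.Properties using () renaming (_≟_ to _≟ᶠ_)
open import Data.List using (List; length; filter; map; concatMap; allFin)
open import Data.Product using (Σ; _×_; _,_)
open import Relation.Nullary using (¬_; does)
open import Relation.Binary.PropositionalEquality using (_≡_)
open import Function.Definitions using (Injective)

record Graph (n : ℕ) : Set where
  field
    adj    : Fin n → Fin n → Bool
    sym    : ∀ i j → adj i j ≡ adj j i
    irrefl : ∀ i → adj i i ≡ false
open Graph public

-- An edge-colouring: a colour in ℕ for every (unordered) pair; only the
-- values on edges matter.  Symmetry makes it a function of unordered pairs.
record Colouring (n : ℕ) : Set where
  field
    col    : Fin n → Fin n → ℕ
    colSym : ∀ i j → col i j ≡ col j i
open Colouring public

numEdges : ∀ {n} → Graph n → ℕ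
numEdges {n} G =
  length (filter (λ p → Data.Bool._≟_ (test p) true)
           (concatMap (λ i → map (λ j → (i , j)) (allFin n)) (allFin n)))
  where
  test : Fin n × Fin n → Bool
  test (i , j) = (toℕ i <ᵇ toℕ j) ∧ adj G i j

cycleAdj : (r : ℕ) → Fin r → Fin r → Bool
cycleAdj r i j =
  (suc (toℕ i) ≡ᵇ toℕ j) ∨ (suc (toℕ j) ≡ᵇ toℕ i)
  ∨ ((toℕ i ≡ᵇ 0) ∧ (suc (toℕ j) ≡ᵇ r))
  ∨ ((toℕ j ≡ᵇ 0) ∧ (suc (toℕ i) ≡ᵇ r))

RainbowCopy : ∀ {k n} → (Fin k → Fin k → Bool)
            → (Fin n → Fin n → Bool) → (Fin n → Fin n → ℕ) → Set
RainbowCopy {k} {n} F adjG colG =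
  Σ (Fin k → Fin n) λ φ →
    Injective _≡_ _≡_ φ
    × (∀ a b → F a b ≡ true → adjG (φ a) (φ b) ≡ true)
    × (∀ a b c d → F a b ≡ true → F c d ≡ true
         → ¬ (a ≡ c × b ≡ d) → ¬ (a ≡ d × b ≡ c)
         → ¬ (colG (φ a) (φ b) ≡ colG (φ c) (φ d)))

addAdj : ∀ {n} → (Fin n → Fin n → Bool) → Fin n → Fin n → Fin n → Fin n → Bool
addAdj adjG u v i j =
  adjG i j ∨ (does (i ≟ᶠ u) ∧ does (j ≟ᶠ v)) ∨ (does (i ≟ᶠ v) ∧ does (j ≟ᶠ u))

addCol : ∀ {n} → (Fin n → Fin n → ℕ) → Fin n → Fin n → ℕ → Fin n → Fin n → ℕ
addCol colG u v α i j =
  if (does (i ≟ᶠ u) ∧ does (j ≟ᶠ v)) ∨ (does (i ≟ᶠ v) ∧ does (j ≟ᶠ u))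
  then α else colG i j

RainbowFree : ∀ {k n} → (Fin k → Fin k → Bool) → Graph n → Colouring n → Set
RainbowFree F G c = ¬ RainbowCopy F (adj G) (col c)

RainbowSaturated : ∀ {k n} → (Fin k → Fin k → Bool) → Graph n → Colouring n → Set
RainbowSaturated {n = n} F G c =
  RainbowFree F G c
  × (∀ (u v : Fin n) → ¬ (u ≡ v) → adj G u v ≡ false → (α : ℕ)
       → RainbowCopy F (addAdj (adj G) u v) (addCol (col c) u v α))

RsatAtMost : ∀ {k} → ℕ → (Fin k → Fin k → Bool) → ℕ → Set
RsatAtMost n F m =
  Σ (Graph n) λ G → Σ (Colouring n) λ c →
    RainbowSaturated F G c × (numEdges G Data.Nat.≤ m)

-- P (rsat(n,F)) for a monotone lower-bound predicate: every graph on n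
-- vertices admitting an F-rainbow saturated colouring has e edges with P e.
RsatLowerBound : ∀ {k} → ℕ → (Fin k → Fin k → Bool) → (ℕ → Set) → Set
RsatLowerBound n F P =
  ∀ (G : Graph n) (c : Colouring n) → RainbowSaturated F G c → P (numEdges G)

{-# OPTIONS --safe #-}

-- Lower bound. Every vertex has at least two neighbours, and if a and b are the only neighbours of u, then
-- every further vertex is reached from a, and from b, by a path with three edges that avoids u. If no vertex
-- has degree two, then 2e ≥ 3n. Otherwise take a vertex v of degree two, with nonadjacent neighbours if
-- possible; all distances from v are at most 4. Give every edge weight 4 and split it between its ends,
-- by default entirely to the end farther from v (3 to 1 between the levels 4 and 3), and evenly within a level.
-- A vertex outside N[v] gets less than 6 this way only if it is a "bad" vertex of level 2, whose neighbours
-- are one vertex of level 1 and otherwise lie at level 3; these level-3 neighbours can hand over the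
-- missing 2. As v gets 8, this yields 4e ≥ 6(n - 3) + 8.
--
-- Upper bound. Take a K₄ on {0,2,3,4}, triangles {2,5,6}, {3,7,8}, {4,9,10}, an edge 01, and let the
-- n - 11 remaining vertices ("pages") be adjacent to 0 and 1; all edges get distinct colours. There is no
-- 5-cycle, and any two nonadjacent vertices lie in a copy of the case n = 15, where they are joined by paths
-- with four edges that have no common edge.

module Submission where

open import Defs
open import Data.Nat
open import Data.Product using (∃; _×_; _,_; proj₁; proj₂)
open import Data.Bool using (Bool; true; false; _∧_; _∨_; if_then_else_)
import Data.Bool as Bool
open import Data.Bool.ListAction using (any)
import Data.Bool.Properties as Bool
open import Data.Fin using (Fin; zero; suc; toℕ; fromℕ<; combine; inject₁; _↑ˡ_; #_)
open import Data.Fin.Patterns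
open import Data.Fin.Permutation.Components using (transpose; transpose-inverse)
open import Data.Fin.Properties
  using (any?; all?; toℕ-injective; toℕ-fromℕ<; toℕ-↑ˡ; combine-injective; ↑ˡ-injective)
  renaming (_≟_ to _≟ᶠ_)
open import Data.List using (List; []; _∷_; length; filter; map; concatMap; allFin; tabulate)
open import Data.List.Properties using (filter-++; length-++; map-tabulate)
open import Data.Nat.Properties
open import Algebra.Properties.CommutativeMonoid.Sum +-0-commutativeMonoid
  using (sum; ∑-distrib-+; ∑-comm; sum-cong-≗)
open import Data.Nat.Tactic.RingSolver using (solve-∀)
import Data.Product
open import Data.Sum using (_⊎_; inj₁; inj₂; [_,_])
open import Data.Vec using (Vec; []; _∷_; lookup)
import Data.Vec.Relation.Unary.AllPairs as AllPairs
open import Data.Vec.Relation.Unary.Unique.Propositional using (Unique)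
open import Data.Vec.Relation.Unary.Unique.Propositional.Properties using (lookup-injective)
open import Function using (_∘_; id; Equivalence)
open import Function.Definitions using (Injective)
open import Relation.Binary using (tri<; tri≈; tri>)
open import Relation.Binary.PropositionalEquality hiding (sym; [_]) renaming (trans to ≡-trans)
import Relation.Binary.PropositionalEquality as ≡
open import Relation.Nullary using (¬_; Dec; yes; no; does; contradiction)
open import Relation.Nullary.Decidable
  using (_×-dec_; _→-dec_; _⊎-dec_; ¬?; from-yes; decidable-stable; dec-true; dec-false)
open import Relation.Unary using (Decidable)

-- Finite sums and weights on edges

𝟙 : Bool → ℕ
𝟙 true  = 1
𝟙 false = 0

sum-mono-≤ : ∀ {n} {f g : Fin n → ℕ} → (∀ i → f i ≤ g i) → sum f ≤ sum g
sum-mono-≤ {zero}  f≤g = z≤n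
sum-mono-≤ {suc n} f≤g = +-mono-≤ (f≤g zero) (sum-mono-≤ (f≤g ∘ suc))

sum-const : ∀ n c → sum {n} (λ _ → c) ≡ n * c
sum-const zero    c = refl
sum-const (suc n) c = cong (c +_) (sum-const n c)

sum-zero : ∀ {n} {f : Fin n → ℕ} → (∀ i → f i ≡ 0) → sum f ≡ 0
sum-zero {n} f≡0 = ≡-trans (sum-cong-≗ f≡0) (≡-trans (sum-const n 0) (*-zeroʳ n))

sum-*ˡ : ∀ {n} c (f : Fin n → ℕ) → sum (λ i → c * f i) ≡ c * sum f
sum-*ˡ {zero}  c f = ≡.sym (*-zeroʳ c)
sum-*ˡ {suc n} c f = ≡-trans (cong (c * f zero +_) (sum-*ˡ c (f ∘ suc)))
                             (≡.sym (*-distribˡ-+ c (f zero) _))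

sum-indicator : ∀ {n} (a : Fin n) → sum (λ i → 𝟙 (does (i ≟ᶠ a))) ≡ 1
sum-indicator {suc n} zero    = cong suc (≡-trans (sum-const n 0) (*-zeroʳ n))
sum-indicator {suc n} (suc a) = sum-indicator a

term≤sum : ∀ {n} (f : Fin n → ℕ) a → f a ≤ sum f
term≤sum f zero    = m≤m+n _ _
term≤sum f (suc a) = ≤-trans (term≤sum (f ∘ suc) a) (m≤n+m _ _)

two-terms≤sum : ∀ {n} (f : Fin n → ℕ) {a b} → a ≢ b → f a + f b ≤ sum f
two-terms≤sum f {zero}  {zero}  a≢b = contradiction refl a≢b
two-terms≤sum f {zero}  {suc b} a≢b = +-monoʳ-≤ (f zero) (term≤sum (f ∘ suc) b)
two-terms≤sum f {suc a} {zero}  a≢b =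
  ≤-trans (≤-reflexive (+-comm (f (suc a)) _)) (+-monoʳ-≤ (f zero) (term≤sum (f ∘ suc) a))
two-terms≤sum f {suc a} {suc b} a≢b =
  ≤-trans (two-terms≤sum (f ∘ suc) (a≢b ∘ cong suc)) (m≤n+m _ _)

three-terms≤sum : ∀ {n} (f : Fin n → ℕ) {a b c} → a ≢ b → a ≢ c → b ≢ c →
                  f a + (f b + f c) ≤ sum f
three-terms≤sum f {zero} {zero} a≢b _ _ = contradiction refl a≢b
three-terms≤sum f {zero} {suc b} {zero} _ a≢c _ = contradiction refl a≢c
three-terms≤sum f {zero} {suc b} {suc c} _ _ b≢c =
  +-monoʳ-≤ (f zero) (two-terms≤sum (f ∘ suc) (b≢c ∘ cong suc))
three-terms≤sum f {suc a} {zero} {zero} _ _ b≢c = contradiction refl b≢c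
three-terms≤sum f {suc a} {zero} {suc c} _ a≢c _ =
  ≤-trans (≤-reflexive (swap (f (suc a)) (f zero) (f (suc c))))
          (+-monoʳ-≤ (f zero) (two-terms≤sum (f ∘ suc) (a≢c ∘ cong suc)))
  where
  swap : ∀ p q r → p + (q + r) ≡ q + (p + r)
  swap = solve-∀
three-terms≤sum f {suc a} {suc b} {zero} a≢b _ _ =
  ≤-trans (≤-reflexive (rotate (f (suc a)) (f (suc b)) (f zero)))
          (+-monoʳ-≤ (f zero) (two-terms≤sum (f ∘ suc) (a≢b ∘ cong suc)))
  where
  rotate : ∀ p q r → p + (q + r) ≡ r + (p + q)
  rotate = solve-∀
three-terms≤sum f {suc a} {suc b} {suc c} a≢b a≢c b≢c =
  ≤-trans (three-terms≤sum (f ∘ suc) (a≢b ∘ cong suc) (a≢c ∘ cong suc) (b≢c ∘ cong suc))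
          (m≤n+m _ _)

module _ {A : Set} {P : A → Set} (P? : Decidable P) where

  length-filter-tabulate : ∀ {n} (f : Fin n → A) →
    length (filter P? (tabulate f)) ≡ sum (λ i → 𝟙 (does (P? (f i))))
  length-filter-tabulate {zero}  f = refl
  length-filter-tabulate {suc n} f with does (P? (f zero))
  ... | true  = cong suc (length-filter-tabulate (f ∘ suc))
  ... | false = length-filter-tabulate (f ∘ suc)

  length-filter-concatMap : ∀ {n} {B : Set} (f : B → List A) (g : Fin n → B) →
    length (filter P? (concatMap f (tabulate g))) ≡ sum (λ i → length (filter P? (f (g i))))
  length-filter-concatMap {zero}  f g = refl
  length-filter-concatMap {suc n} f g =
    ≡-trans (cong length (filter-++ P? (f (g zero)) _))
    (≡-trans (length-++ (filter P? (f (g zero))))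
             (cong (length (filter P? (f (g zero))) +_) (length-filter-concatMap f (g ∘ suc))))

length-filter-pairs : ∀ {n} {P : Fin n × Fin n → Set} (P? : Decidable P) →
  length (filter P? (concatMap (λ i → map (λ j → (i , j)) (allFin n)) (allFin n)))
    ≡ sum (λ i → sum (λ j → 𝟙 (does (P? (i , j)))))
length-filter-pairs P? =
  ≡-trans (length-filter-concatMap P? (λ i → map (λ j → (i , j)) (allFin _)) id)
          (sum-cong-≗ λ i → ≡-trans (cong (length ∘ filter P?) (map-tabulate id (i ,_)))
                                    (length-filter-tabulate P? (i ,_)))

forward : ∀ {n} → Graph n → Fin n → Fin n → ℕ
forward G i j = 𝟙 ((toℕ i <ᵇ toℕ j) ∧ adj G i j)

numEdges≡sum : ∀ {n} (G : Graph n) → numEdges G ≡ sum (λ i → sum (forward G i))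
numEdges≡sum {n} G = ≡-trans
  (length-filter-pairs {n} (λ (i , j) → ((toℕ i <ᵇ toℕ j) ∧ adj G i j) Data.Bool.≟ true))
  (sum-cong-≗ λ i → sum-cong-≗ λ j → 𝟙-≟-true ((toℕ i <ᵇ toℕ j) ∧ adj G i j))
  where
  𝟙-≟-true : ∀ b → 𝟙 (does (b Data.Bool.≟ true)) ≡ 𝟙 b
  𝟙-≟-true true  = refl
  𝟙-≟-true false = refl

weightAt : ∀ {n} → Graph n → (Fin n → Fin n → ℕ) → Fin n → ℕ
weightAt G φ u = sum (λ w → 𝟙 (adj G u w) * φ u w)

<ᵇ-true : ∀ {k l} → k < l → (k <ᵇ l) ≡ true
<ᵇ-true k<l = Bool.T-≡ .Equivalence.to (<⇒<ᵇ k<l)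
<ᵇ-false : ∀ {k l} → ¬ (k < l) → (k <ᵇ l) ≡ false
<ᵇ-false {k} {l} k≮l with k <ᵇ l in eq
... | false = refl
... | true  = contradiction (<ᵇ⇒< k l (Bool.T-≡ .Equivalence.from eq)) k≮l

-- Double counting: the two ends of an edge together get `c`. Each ordered pair is attributed to its
-- increasing orientation, and exchanging the summations for the decreasing pairs brings the two
-- shares of an edge together.
weighted-handshake : ∀ {n} (G : Graph n) (φ : Fin n → Fin n → ℕ) c →
  (∀ i j → φ i j + φ j i ≡ c) → sum (weightAt G φ) ≡ c * numEdges G
weighted-handshake {n} G φ c splits = begin
  sum (λ i → sum (λ j → 𝟙 (adj G i j) * φ i j))
    ≡⟨ sum-cong-≗ (λ i → sum-cong-≗ (λ j → orient i j)) ⟩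
  sum (λ i → sum (λ j → up i j + down i j))
    ≡⟨ sum-cong-≗ (λ i → ∑-distrib-+ (up i) (down i)) ⟩
  sum (λ i → sum (up i) + sum (down i))
    ≡⟨ ∑-distrib-+ (sum ∘ up) (sum ∘ down) ⟩
  sum (sum ∘ up) + sum (sum ∘ down)
    ≡⟨ cong (sum (sum ∘ up) +_) (∑-comm down) ⟩
  sum (sum ∘ up) + sum (λ j → sum (λ i → down i j))
    ≡⟨ ∑-distrib-+ (sum ∘ up) (λ j → sum (λ i → down i j)) ⟨
  sum (λ i → sum (up i) + sum (λ j → down j i))
    ≡⟨ sum-cong-≗ (λ i → ∑-distrib-+ (up i) (λ j → down j i)) ⟨
  sum (λ i → sum (λ j → up i j + down j i))
    ≡⟨ sum-cong-≗ (λ i → sum-cong-≗ (λ j → merge i j)) ⟩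
  sum (λ i → sum (λ j → c * forward G i j))
    ≡⟨ sum-cong-≗ (λ i → sum-*ˡ c (forward G i)) ⟩
  sum (λ i → c * sum (forward G i))
    ≡⟨ sum-*ˡ c (λ i → sum (forward G i)) ⟩
  c * sum (λ i → sum (forward G i))
    ≡⟨ cong (c *_) (numEdges≡sum G) ⟨
  c * numEdges G ∎
  where
  open ≡-Reasoning
  up down : Fin n → Fin n → ℕ
  up   i j = forward G i j * φ i j
  down i j = forward G j i * φ i j
  merge : ∀ i j → up i j + down j i ≡ c * forward G i j
  merge i j = ≡-trans (≡.sym (*-distribˡ-+ (forward G i j) (φ i j) (φ j i)))
              (≡-trans (cong (forward G i j *_) (splits i j)) (*-comm (forward G i j) c))
  orient : ∀ i j → 𝟙 (adj G i j) * φ i j ≡ up i j + down i j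
  orient i j with <-cmp (toℕ i) (toℕ j)
  ... | tri< i<j _ j≮i rewrite <ᵇ-true i<j | <ᵇ-false j≮i = ≡.sym (+-identityʳ _)
  ... | tri> i≮j _ j<i rewrite <ᵇ-true j<i | <ᵇ-false i≮j | Graph.sym G i j = refl
  ... | tri≈ i≮j i≡j _ rewrite toℕ-injective i≡j | <ᵇ-false (n≮n (toℕ j)) | irrefl G j = refl

-- Rainbow paths with four edges between nonadjacent vertices

Cycle5 : Fin 5 → Fin 5 → Set
Cycle5 a b = cycleAdj 5 a b ≡ true

opaque
  -- The other way round the pentagon. The inequalities separate the detour from the edge `ab` and
  -- keep its vertices apart, as `Path` requires; enumeration decides everything.
  cycle-detour : ∀ a b → Cycle5 a b → ∃ λ p → ∃ λ q → ∃ λ r →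
    (Cycle5 a p × Cycle5 p q × Cycle5 q r × Cycle5 r b)
    × (a ≢ q × a ≢ r × p ≢ r × p ≢ b × q ≢ b × a ≢ b × a ≢ p × b ≢ r)
  cycle-detour = from-yes
    (all? λ a → all? λ b → (cycleAdj 5 a b Bool.≟ true) →-dec
      any? λ p → any? λ q → any? λ r →
        ((cycleAdj 5 a p Bool.≟ true) ×-dec (cycleAdj 5 p q Bool.≟ true) ×-dec
         (cycleAdj 5 q r Bool.≟ true) ×-dec (cycleAdj 5 r b Bool.≟ true))
        ×-dec (¬? (a ≟ᶠ q) ×-dec ¬? (a ≟ᶠ r) ×-dec ¬? (p ≟ᶠ r) ×-dec ¬? (p ≟ᶠ b) ×-dec
               ¬? (q ≟ᶠ b) ×-dec ¬? (a ≟ᶠ b) ×-dec ¬? (a ≟ᶠ p) ×-dec ¬? (b ≟ᶠ r)))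

  cycle-sym : ∀ a b → Cycle5 a b → Cycle5 b a
  cycle-sym = from-yes (all? λ a → all? λ b →
    (cycleAdj 5 a b Bool.≟ true) →-dec (cycleAdj 5 b a Bool.≟ true))

module _ {n} (u v : Fin n) where

  private
    hit : Fin n → Fin n → Bool
    hit i j = (does (i ≟ᶠ u) ∧ does (j ≟ᶠ v)) ∨ (does (i ≟ᶠ v) ∧ does (j ≟ᶠ u))

    hit-self : hit u v ≡ true
    hit-self with u ≟ᶠ u | v ≟ᶠ v
    ... | yes _ | yes _ = refl
    ... | no u≢u | _ = contradiction refl u≢u
    ... | yes _ | no v≢v = contradiction refl v≢v

    miss : ∀ {i j} → ¬ (i ≡ u × j ≡ v) → ¬ (i ≡ v × j ≡ u) → hit i j ≡ false
    miss {i} {j} ¬uv ¬vu with i ≟ᶠ u | j ≟ᶠ v | i ≟ᶠ v | j ≟ᶠ u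
    ... | yes i≡u | yes j≡v | _ | _ = contradiction (i≡u , j≡v) ¬uv
    ... | _ | _ | yes i≡v | yes j≡u = contradiction (i≡v , j≡u) ¬vu
    ... | no _ | _ | no _ | _ = refl
    ... | no _ | _ | yes _ | no _ = refl
    ... | yes _ | no _ | no _ | _ = refl
    ... | yes _ | no _ | yes _ | no _ = refl

    hit-sym : ∀ i j → hit i j ≡ hit j i
    hit-sym i j = ≡-trans
      (Bool.∨-comm (does (i ≟ᶠ u) ∧ does (j ≟ᶠ v)) (does (i ≟ᶠ v) ∧ does (j ≟ᶠ u)))
      (cong₂ _∨_ (Bool.∧-comm (does (i ≟ᶠ v)) (does (j ≟ᶠ u)))
                 (Bool.∧-comm (does (i ≟ᶠ u)) (does (j ≟ᶠ v))))

  addAdj-sym : ∀ A → (∀ i j → A i j ≡ A j i) → ∀ i j → addAdj A u v i j ≡ addAdj A u v j i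
  addAdj-sym A A-sym i j = cong₂ _∨_ (A-sym i j) (hit-sym i j)

  addCol-sym : ∀ C α → (∀ i j → C i j ≡ C j i) → ∀ i j → addCol C u v α i j ≡ addCol C u v α j i
  addCol-sym C α C-sym i j = cong₂ (if_then α else_) (hit-sym i j) (C-sym i j)

  addCol-new : ∀ C α → addCol C u v α u v ≡ α
  addCol-new C α rewrite hit-self = refl

  addAdj-new : ∀ A → addAdj A u v u v ≡ true
  addAdj-new A rewrite hit-self = Bool.∨-zeroʳ (A u v)

  addAdj-old : ∀ A {i j} → ¬ (i ≡ u × j ≡ v) → ¬ (i ≡ v × j ≡ u) → addAdj A u v i j ≡ A i j
  addAdj-old A {i} {j} ¬uv ¬vu rewrite miss ¬uv ¬vu = Bool.∨-identityʳ (A i j)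

  addCol-old : ∀ C α {i j} → ¬ (i ≡ u × j ≡ v) → ¬ (i ≡ v × j ≡ u) → addCol C u v α i j ≡ C i j
  addCol-old C α ¬uv ¬vu rewrite miss ¬uv ¬vu = refl

module Paths {n} (G : Graph n) (c : Colouring n) where

  infix 4 _~_
  _~_ : Fin n → Fin n → Set
  u ~ w = adj G u w ≡ true

  _~?_ : ∀ u w → Dec (u ~ w)
  u ~? w = adj G u w Bool.≟ true

  ~-sym : ∀ {u w} → u ~ w → w ~ u
  ~-sym {u} {w} = ≡-trans (Graph.sym G w u)

  ~-irrefl : ∀ {u} → ¬ u ~ u
  ~-irrefl {u} u~u with () ← ≡-trans (≡.sym u~u) (irrefl G u)

  ~⇒≢ : ∀ {u w} → u ~ w → u ≢ w
  ~⇒≢ u~w refl = ~-irrefl u~w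

  -- A path `u p q r w`. The colour condition is recorded for the first edge: choosing `α` later
  -- serves to control how the path leaves `u`.
  record Path (u w : Fin n) (α : ℕ) : Set where
    field
      {p q r} : Fin n
      u~p : u ~ p
      p~q : p ~ q
      q~r : q ~ r
      r~w : r ~ w
      q≢u : q ≢ u
      r≢u : r ≢ u
      r≢p : r ≢ p
      q≢w : q ≢ w
      avoids : col c u p ≢ α

  opaque
    -- A rainbow pentagon that arises when `uw` is added with colour `α` must use `uw`, since
    -- otherwise it would already lie in the graph. Deleting this edge leaves the path, and no
    -- remaining edge has colour `α`.
    saturated⇒path : RainbowSaturated (cycleAdj 5) G c →
                     ∀ {u w} → u ≢ w → ¬ u ~ w → ∀ α → Path u w α
    saturated⇒path (free , sat) {u} {w} u≢w u≁w α
      with sat u w u≢w (Bool.¬-not u≁w) α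
    ... | φ , φ-inj , φ-adj , φ-rainbow
      with any? (λ a → any? λ b → (cycleAdj 5 a b Bool.≟ true) ×-dec (φ a ≟ᶠ u) ×-dec (φ b ≟ᶠ w))
    ... | no unused = contradiction (φ , (λ {_} {_} → φ-inj) , adj′ , rainbow′) free
      where
      ¬uw : ∀ {a b} → Cycle5 a b → ¬ (φ a ≡ u × φ b ≡ w)
      ¬uw {a} {b} ab (a↦u , b↦w) = unused (a , b , ab , a↦u , b↦w)
      ¬wu : ∀ {a b} → Cycle5 a b → ¬ (φ a ≡ w × φ b ≡ u)
      ¬wu {a} {b} ab (a↦w , b↦u) = unused (b , a , cycle-sym a b ab , b↦u , a↦w)
      adj′ : ∀ a b → Cycle5 a b → φ a ~ φ b
      adj′ a b ab = ≡-trans (≡.sym (addAdj-old u w (adj G) (¬uw ab) (¬wu ab))) (φ-adj a b ab)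
      rainbow′ : ∀ a b d e → Cycle5 a b → Cycle5 d e → ¬ (a ≡ d × b ≡ e) → ¬ (a ≡ e × b ≡ d) →
                 col c (φ a) (φ b) ≢ col c (φ d) (φ e)
      rainbow′ a b d e ab de ≢₁ ≢₂ same = φ-rainbow a b d e ab de ≢₁ ≢₂
        (≡-trans (addCol-old u w (col c) α (¬uw ab) (¬wu ab))
        (≡-trans same (≡.sym (addCol-old u w (col c) α (¬uw de) (¬wu de)))))
    ... | yes (a , b , ab , refl , refl)
      with cycle-detour a b ab
    ... | p , q , r , (ap , pq , qr , rb) , (a≢q , a≢r , p≢r , p≢b , q≢b , a≢b , a≢p , b≢r) = record
      { u~p = old ap (p≢b ∘ proj₂) (a≢b ∘ proj₁)
      ; p~q = old pq (q≢b ∘ proj₂) (p≢b ∘ proj₁)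
      ; q~r = old qr (a≢q ∘ ≡.sym ∘ proj₁) (q≢b ∘ proj₁)
      ; r~w = old rb (a≢r ∘ ≡.sym ∘ proj₁) (b≢r ∘ ≡.sym ∘ proj₁)
      ; q≢u = a≢q ∘ ≡.sym ∘ φ-inj
      ; r≢u = a≢r ∘ ≡.sym ∘ φ-inj
      ; r≢p = p≢r ∘ ≡.sym ∘ φ-inj
      ; q≢w = q≢b ∘ φ-inj
      ; avoids = λ same → φ-rainbow a p a b ap ab (p≢b ∘ proj₂) (a≢b ∘ proj₁)
          (≡-trans (addCol-old (φ a) (φ b) (col c) α (λ (_ , e) → p≢b (φ-inj e)) (λ (e , _) → a≢b (φ-inj e)))
          (≡-trans same (≡.sym (addCol-new (φ a) (φ b) (col c) α))))
      }
      where
      old : ∀ {i j} → Cycle5 i j → ¬ (i ≡ a × j ≡ b) → ¬ (i ≡ b × j ≡ a) → φ i ~ φ j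
      old ij ¬ab ¬ba = ≡-trans
        (≡.sym (addAdj-old (φ a) (φ b) (adj G)
          (λ (e , f) → ¬ab (φ-inj e , φ-inj f)) (λ (e , f) → ¬ba (φ-inj e , φ-inj f))))
        (φ-adj _ _ ij)

-- The lower bound

-- Serves to define the distance from the root as the least length of a walk.
least : {P : ℕ → Set} → Decidable P → ∀ k → P k →
        ∃ λ m → m ≤ k × P m × (∀ j → P j → m ≤ j)
least P? zero    p = zero , z≤n , p , λ _ _ → z≤n
least P? (suc k) p with P? 0
... | yes p₀ = zero , z≤n , p₀ , λ _ _ → z≤n
... | no ¬p₀ with least (P? ∘ suc) k p
...   | m , m≤k , pm , min = suc m , s≤s m≤k , pm ,
        λ { zero p₀ → contradiction p₀ ¬p₀ ; (suc j) pj → s≤s (min j pj) }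

either-of-two : ∀ {k m} → k ≤ m → m ≤ suc k → m ≡ k ⊎ m ≡ suc k
either-of-two {k} {m} k≤m m≤1+k with m≤n⇒m<n∨m≡n k≤m
... | inj₁ k<m = inj₂ (≤-antisym m≤1+k k<m)
... | inj₂ k≡m = inj₁ (≡.sym k≡m)

-- Consequences of saturation for degrees and bypasses

module Saturated {n} (G : Graph n) (c : Colouring n)
  (sat : RainbowSaturated (cycleAdj 5) G c)
  (two-others : ∀ (u : Fin n) → ∃ λ a → ∃ λ b → u ≢ a × u ≢ b × a ≢ b) where

  open Paths G c public

  nbrSum : (Fin n → ℕ) → Fin n → ℕ
  nbrSum f u = sum (λ w → 𝟙 (adj G u w) * f w)

  nbr-term : ∀ (f : Fin n → ℕ) {u w k} → u ~ w → k ≤ f w → k ≤ 𝟙 (adj G u w) * f w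
  nbr-term f {w = w} u~w k≤f rewrite u~w = ≤-trans k≤f (≤-reflexive (≡.sym (*-identityˡ (f w))))

  two-nbrs : ∀ {f : Fin n → ℕ} {u a b k l} → u ~ a → u ~ b → a ≢ b →
             k ≤ f a → l ≤ f b → k + l ≤ nbrSum f u
  two-nbrs {f} u~a u~b a≢b k≤ l≤ =
    ≤-trans (+-mono-≤ (nbr-term f u~a k≤) (nbr-term f u~b l≤)) (two-terms≤sum _ a≢b)

  three-nbrs : ∀ {f : Fin n → ℕ} {u a b d k l m} → u ~ a → u ~ b → u ~ d →
               a ≢ b → a ≢ d → b ≢ d → k ≤ f a → l ≤ f b → m ≤ f d → k + (l + m) ≤ nbrSum f u
  three-nbrs {f} u~a u~b u~d a≢b a≢d b≢d k≤ l≤ m≤ =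
    ≤-trans (+-mono-≤ (nbr-term f u~a k≤) (+-mono-≤ (nbr-term f u~b l≤) (nbr-term f u~d m≤)))
            (three-terms≤sum _ a≢b a≢d b≢d)

  opaque
    -- Saturation at a nonneighbour is used twice. The second time the nonedge gets the colour of
    -- the first edge found, so the second path leaves `u` along a different edge. A vertex without
    -- nonneighbours takes its neighbours from `two-others`.
    two-neighbours : ∀ u → ∃ λ a → ∃ λ b → u ~ a × u ~ b × a ≢ b
    two-neighbours u with any? (λ w → ¬? (u ≟ᶠ w) ×-dec ¬? (u ~? w))
    ... | yes (w , u≢w , u≁w) = P.p , Q.p , P.u~p , Q.u~p , λ p≡p′ → Q.avoids (cong (col c u) (≡.sym p≡p′))
      where
      module P = Path (saturated⇒path sat u≢w u≁w 0)
      module Q = Path (saturated⇒path sat u≢w u≁w (col c u P.p))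
    ... | no full with two-others u
    ...   | a , b , u≢a , u≢b , a≢b = a , b , adjacent u≢a , adjacent u≢b , a≢b
      where
      adjacent : ∀ {w} → u ≢ w → u ~ w
      adjacent {w} u≢w = decidable-stable (u ~? w) (λ u≁w → full (w , u≢w , u≁w))

  opaque
    other-neighbour : ∀ {u p} → u ~ p → ∃ λ q → u ~ q × p ≢ q
    other-neighbour {u} {p} u~p with two-neighbours u
    ... | a , b , u~a , u~b , a≢b with p ≟ᶠ a
    ...   | yes refl = b , u~b , a≢b
    ...   | no  p≢a  = a , u~a , p≢a

  Deg2 : Fin n → Fin n → Fin n → Set
  Deg2 u a b = u ~ a × u ~ b × a ≢ b × (∀ w → u ~ w → w ≡ a ⊎ w ≡ b)

  deg2? : ∀ u a b → Dec (Deg2 u a b)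
  deg2? u a b = (u ~? a) ×-dec (u ~? b) ×-dec ¬? (a ≟ᶠ b) ×-dec
    all? (λ w → (u ~? w) →-dec ((w ≟ᶠ a) ⊎-dec (w ≟ᶠ b)))

  deg2-flip : ∀ {u a b} → Deg2 u a b → Deg2 u b a
  deg2-flip (u~a , u~b , a≢b , only) = u~b , u~a , a≢b ∘ ≡.sym ,
    λ w u~w → Data.Sum.swap (only w u~w)

  opaque
    third-neighbour : ∀ {u a b} → u ~ a → u ~ b → a ≢ b →
                      (∃ λ r → u ~ r × a ≢ r × b ≢ r) ⊎ Deg2 u a b
    third-neighbour {u} {a} {b} u~a u~b a≢b
      with any? (λ r → (u ~? r) ×-dec ¬? (a ≟ᶠ r) ×-dec ¬? (b ≟ᶠ r))
    ... | yes third = inj₁ third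
    ... | no  none  = inj₂ (u~a , u~b , a≢b , only)
      where
      only : ∀ w → u ~ w → w ≡ a ⊎ w ≡ b
      only w u~w with w ≟ᶠ a | w ≟ᶠ b
      ... | yes w≡a | _       = inj₁ w≡a
      ... | no _    | yes w≡b = inj₂ w≡b
      ... | no w≢a  | no w≢b  = contradiction (w , u~w , w≢a ∘ ≡.sym , w≢b ∘ ≡.sym) none

  -- What remains of a path `u a q r w` after its first edge.
  record Bypass (u a w : Fin n) : Set where
    field
      {q r} : Fin n
      a~q : a ~ q
      q~r : q ~ r
      r~w : r ~ w
      q≢u : q ≢ u
      r≢u : r ≢ u
      r≢a : r ≢ a
      q≢w : q ≢ w

  opaque
    -- Colour the nonedge uw like the edge ub: the 4-path from u to w then has to leave u through a.
    bypass : ∀ {u a b w} → Deg2 u a b → w ≢ u → w ≢ a → w ≢ b → Bypass u a w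
    bypass {u} {a} {b} {w} (u~a , u~b , a≢b , only) w≢u w≢a w≢b = from-path (only P.p P.u~p)
      where
      u≁w : ¬ u ~ w
      u≁w u~w with only w u~w
      ... | inj₁ w≡a = w≢a w≡a
      ... | inj₂ w≡b = w≢b w≡b
      module P = Path (saturated⇒path sat (w≢u ∘ ≡.sym) u≁w (col c u b))
      from-path : P.p ≡ a ⊎ P.p ≡ b → Bypass u a w
      from-path (inj₂ p≡b) = contradiction (cong (col c u) p≡b) P.avoids
      from-path (inj₁ p≡a) = record
        { a~q = subst (_~ P.q) p≡a P.p~q ; q~r = P.q~r ; r~w = P.r~w
        ; q≢u = P.q≢u ; r≢u = P.r≢u ; r≢a = λ r≡a → P.r≢p (≡-trans r≡a (≡.sym p≡a)) ; q≢w = P.q≢w }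

  -- The two outcomes of the choice of `v`: preferably its own neighbours are nonadjacent; if no
  -- vertex of degree two allows this, each of them forms a triangle with its neighbours.
  Triangles : Fin n → Set
  Triangles v = (∀ {u a b} → Deg2 u a b → a ~ b) ⊎ (∀ {a b} → Deg2 v a b → ¬ a ~ b)

  -- Levels around a vertex of degree two

  module Rooted {v x y : Fin n} (v-deg2 : Deg2 v x y) (triangles : Triangles v) where

    data Walk : ℕ → Fin n → Set where
      here : Walk 0 v
      step : ∀ {k u w} → Walk k u → u ~ w → Walk (suc k) w

    walk? : ∀ k u → Dec (Walk k u)
    walk? zero u with u ≟ᶠ v
    ... | yes refl = yes here
    ... | no  u≢v  = no λ { here → u≢v refl }
    walk? (suc k) u with any? (λ w → walk? k w ×-dec (w ~? u))
    ... | yes (w , ω , w~u) = yes (step ω w~u)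
    ... | no  none          = no λ { (step ω w~u) → none (_ , ω , w~u) }

    v~x : v ~ x
    v~x = proj₁ v-deg2

    v~y : v ~ y
    v~y = proj₁ (proj₂ v-deg2)

    reach : ∀ u → ∃ λ k → k ≤ 4 × Walk k u
    reach u with u ≟ᶠ v | u ≟ᶠ x | u ≟ᶠ y
    ... | yes refl | _ | _ = 0 , z≤n , here
    ... | no _ | yes refl | _ = 1 , s≤s z≤n , step here v~x
    ... | no _ | no _ | yes refl = 1 , s≤s z≤n , step here v~y
    -- The edge `vx` followed by the three edges of a bypass gives the bound 4.
    ... | no u≢v | no u≢x | no u≢y = 4 , ≤-refl , step (step (step (step here v~x) B.a~q) B.q~r) B.r~w
      where module B = Bypass (bypass v-deg2 u≢v u≢x u≢y)

    opaque
      lev : Fin n → ℕ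
      lev u = proj₁ (least (λ k → walk? k u) _ (proj₂ (proj₂ (reach u))))

      lev-≤4 : ∀ u → lev u ≤ 4
      lev-≤4 u = ≤-trans (proj₁ (proj₂ (least (λ k → walk? k u) _ (proj₂ (proj₂ (reach u))))))
                         (proj₁ (proj₂ (reach u)))

      lev-walk : ∀ u → Walk (lev u) u
      lev-walk u = proj₁ (proj₂ (proj₂ (least (λ k → walk? k u) _ (proj₂ (proj₂ (reach u))))))

      lev-min : ∀ {k u} → Walk k u → lev u ≤ k
      lev-min {k} {u} = proj₂ (proj₂ (proj₂ (least (λ k → walk? k u) _ (proj₂ (proj₂ (reach u)))))) k

    lev-step : ∀ {u w} → u ~ w → lev w ≤ suc (lev u)
    lev-step u~w = lev-min (step (lev-walk _) u~w)

    lev-v : lev v ≡ 0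
    lev-v = n≤0⇒n≡0 (lev-min here)

    lev≡0⇒v : ∀ {u} → lev u ≡ 0 → u ≡ v
    lev≡0⇒v {u} lev≡0 with here ← subst (λ k → Walk k u) lev≡0 (lev-walk u) = refl

    opaque
      parent : ∀ {u k} → lev u ≡ suc k → ∃ λ p → u ~ p × lev p ≡ k
      parent {u} {k} lev≡ with step {u = p} ω p~u ← subst (λ k → Walk k u) lev≡ (lev-walk u) =
        p , ~-sym p~u , ≤-antisym (lev-min ω) (s≤s⁻¹ (≤-trans (≤-reflexive (≡.sym lev≡)) (lev-step p~u)))

    opaque
      -- Restores the symmetry between `x` and `y`: whichever of them `p` is, it can act as the
      -- first neighbour of `v`.
      lev≡1⇒deg2 : ∀ {p} → lev p ≡ 1 → ∃ λ q → Deg2 v p q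
      lev≡1⇒deg2 {p} lev≡1 with parent lev≡1
      ... | w , p~w , lev≡0 with proj₂ (proj₂ (proj₂ v-deg2)) p (~-sym (subst (p ~_) (lev≡0⇒v lev≡0) p~w))
      ... | inj₁ refl = y , v-deg2
      ... | inj₂ refl = x , deg2-flip v-deg2

    v~⇒lev≡1 : ∀ {p} → v ~ p → lev p ≡ 1
    v~⇒lev≡1 {p} v~p with lev p in eq | lev-min (step here v~p)
    ... | 0 | _ = contradiction (subst (v ~_) (lev≡0⇒v eq) v~p) ~-irrefl
    ... | 1 | _ = refl
    ... | suc (suc _) | s≤s ()

    lev≤ : ∀ {u w k} → u ~ w → lev u ≤ k → lev w ≤ suc k
    lev≤ u~w lev≤k = ≤-trans (lev-step u~w) (s≤s lev≤k)

    lev≥ : ∀ {u w k} → u ~ w → suc k ≤ lev u → k ≤ lev w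
    lev≥ u~w k<lev = s≤s⁻¹ (≤-trans k<lev (lev-step (~-sym u~w)))

    levs-≢ : ∀ {u w k l} → lev u ≡ k → lev w ≡ l → k ≢ l → u ≢ w
    levs-≢ refl refl k≢l refl = k≢l refl

    -- A vertex of degree two sees v from both of its neighbours within three steps.
    deg2-lev : ∀ {u a b} → Deg2 u a b → 2 ≤ lev u → 1 ≤ lev a → 1 ≤ lev b → lev a ≤ 3
    deg2-lev {u} {a} {b} d lev-u lev-a lev-b =
      lev-min (step (step (step here (~-sym B.r~w)) (~-sym B.q~r)) (~-sym B.a~q))
      where
      v≢ : ∀ {w} → 1 ≤ lev w → v ≢ w
      v≢ 1≤ refl with () ← ≤-trans 1≤ (≤-reflexive lev-v)
      module B = Bypass (bypass d (v≢ (≤-trans (s≤s z≤n) lev-u)) (v≢ lev-a) (v≢ lev-b))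

    -- Bad vertices and the splitting of the edge weights

    Bad : Fin n → Set
    Bad z = lev z ≡ 2 × ¬ ∃ λ p → ∃ λ q → p ≢ q × z ~ p × z ~ q × lev p ≤ 2 × lev q ≤ 2

    bad? : ∀ z → Dec (Bad z)
    bad? z = (lev z ≟ 2) ×-dec ¬? (any? λ p → any? λ q →
      ¬? (p ≟ᶠ q) ×-dec (z ~? p) ×-dec (z ~? q) ×-dec (lev p ≤? 2) ×-dec (lev q ≤? 2))

    bad-unique : ∀ {z p q} → Bad z → z ~ p → z ~ q → lev p ≤ 2 → lev q ≤ 2 → p ≡ q
    bad-unique {z} {p} {q} (_ , ¬two) z~p z~q p≤2 q≤2 =
      decidable-stable (p ≟ᶠ q) (λ p≢q → ¬two (p , q , p≢q , z~p , z~q , p≤2 , q≤2))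

    owed : ℕ → Fin n → ℕ
    owed g w = g * 𝟙 (does (bad? w))

    -- What a vertex of level 3 keeps of its edge to a vertex of level l to which it owes k.
    keepAt : ℕ → ℕ → ℕ
    keepAt 2 k = 4 ∸ k
    keepAt 3 k = 2
    keepAt _ k = 1

    keep : ℕ → Fin n → ℕ
    keep g w = keepAt (lev w) (owed g w)

    -- The total that a vertex of level 3 retains if it hands `g` to each of its bad neighbours.
    kept : ℕ → Fin n → ℕ
    kept g = nbrSum (keep g)

    opaque
      -- The largest amount among 0, 1, 2 that leaves `b` with 6 when every bad neighbour receives
      -- it. Level 3 is thus safe as soon as `kept 0` is at least 6, and a gift is secured by
      -- estimating `kept 1` or `kept 2`.
      gift : Fin n → ℕ
      gift b with 6 ≤? kept 2 b | 6 ≤? kept 1 b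
      ... | yes _ | _     = 2
      ... | no  _ | yes _ = 1
      ... | no  _ | no  _ = 0

      gift-≤2 : ∀ b → gift b ≤ 2
      gift-≤2 b with 6 ≤? kept 2 b | 6 ≤? kept 1 b
      ... | yes _ | _     = ≤-refl
      ... | no  _ | yes _ = s≤s z≤n
      ... | no  _ | no  _ = z≤n

      gift-kept : ∀ b → 6 ≤ kept 0 b → 6 ≤ kept (gift b) b
      gift-kept b 6≤ with 6 ≤? kept 2 b | 6 ≤? kept 1 b
      ... | yes 6≤₂ | _     = 6≤₂
      ... | no  _ | yes 6≤₁ = 6≤₁
      ... | no  _ | no  _   = 6≤

      gift-2 : ∀ b → 6 ≤ kept 2 b → 2 ≤ gift b
      gift-2 b 6≤ with 6 ≤? kept 2 b
      ... | yes _  = ≤-refl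
      ... | no  6≰ = contradiction 6≤ 6≰

      gift-1 : ∀ b → 6 ≤ kept 1 b → 1 ≤ gift b
      gift-1 b 6≤ with 6 ≤? kept 2 b | 6 ≤? kept 1 b
      ... | yes _ | _      = s≤s z≤n
      ... | no  _ | yes _  = ≤-refl
      ... | no  _ | no  6≰ = contradiction 6≤ 6≰

    owed-≤ : ∀ g w → owed g w ≤ g
    owed-≤ g w = ≤-trans (*-monoʳ-≤ g (𝟙≤1 (does (bad? w)))) (≤-reflexive (*-identityʳ g))
      where
      𝟙≤1 : ∀ b → 𝟙 b ≤ 1
      𝟙≤1 true  = ≤-refl
      𝟙≤1 false = z≤n

    owed-good : ∀ g {w} → ¬ Bad w → owed g w ≡ 0
    owed-good g {w} good rewrite dec-false (bad? w) good = *-zeroʳ g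

    owed-bad : ∀ g {w} → Bad w → owed g w ≡ g
    owed-bad g {w} bad rewrite dec-true (bad? w) bad = *-identityʳ g

    keep-2 : ∀ g {w} → lev w ≡ 2 → 4 ∸ g ≤ keep g w
    keep-2 g {w} lev≡2 = subst (λ l → 4 ∸ g ≤ keepAt l (owed g w)) (≡.sym lev≡2)
      (∸-monoʳ-≤ 4 (owed-≤ g w))

    keep-2-good : ∀ g {w} → lev w ≡ 2 → ¬ Bad w → 4 ≤ keep g w
    keep-2-good g {w} lev≡2 good = subst (λ l → 4 ≤ keepAt l (owed g w)) (≡.sym lev≡2)
      (≤-reflexive (cong (4 ∸_) (≡.sym (owed-good g good))))

    keep-3 : ∀ g {w} → lev w ≡ 3 → 2 ≤ keep g w
    keep-3 g {w} lev≡3 = subst (λ l → 2 ≤ keepAt l (owed g w)) (≡.sym lev≡3) ≤-refl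

    keep-≤3 : ∀ g {w} → g ≤ 2 → lev w ≡ 2 ⊎ lev w ≡ 3 → 2 ≤ keep g w
    keep-≤3 g {w} g≤2 (inj₁ lev≡2) = ≤-trans (∸-monoʳ-≤ 4 g≤2) (keep-2 g {w} lev≡2)
    keep-≤3 g {w} g≤2 (inj₂ lev≡3) = keep-3 g {w} lev≡3

    keep-1 : ∀ g w → g ≤ 2 → 1 ≤ keep g w
    keep-1 g w g≤2 = at (lev w)
      where
      at : ∀ l → 1 ≤ keepAt l (owed g w)
      at 0 = ≤-refl
      at 1 = ≤-refl
      at 2 = ≤-trans (s≤s z≤n) (∸-monoʳ-≤ 4 (≤-trans (owed-≤ g w) g≤2))
      at 3 = s≤s z≤n
      at (suc (suc (suc (suc _)))) = ≤-refl

    -- The weight that the farther endpoint u of an edge up between consecutive levels gets.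
    upwardAt : ℕ → ℕ → ℕ
    upwardAt 0 k = 0
    -- The edges at `v` are an exception: they go wholly to the nearer end, which gives `v` its 8.
    upwardAt 1 k = 0
    upwardAt 2 k = 4
    upwardAt 3 k = 4 ∸ k
    upwardAt _ k = 3

    upward : Fin n → Fin n → ℕ
    upward u p = upwardAt (lev u) (owed (gift u) p)

    upward-≤4 : ∀ u p → upward u p ≤ 4
    upward-≤4 u p = at (lev u)
      where
      at : ∀ l → upwardAt l (owed (gift u) p) ≤ 4
      at 0 = z≤n
      at 1 = z≤n
      at 2 = ≤-refl
      at 3 = m∸n≤m 4 (owed (gift u) p)
      at (suc (suc (suc (suc _)))) = n≤1+n 3

    upward-at : ∀ {u p k} → lev u ≡ k → upward u p ≡ upwardAt k (owed (gift u) p)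
    upward-at {u} {p} = cong (λ l → upwardAt l (owed (gift u) p))

    share : Fin n → Fin n → ℕ
    share u w with <-cmp (lev u) (lev w)
    ... | tri< _ _ _ = 4 ∸ upward w u
    ... | tri≈ _ _ _ = 2
    ... | tri> _ _ _ = upward u w

    share-< : ∀ {u w} → lev u < lev w → share u w ≡ 4 ∸ upward w u
    share-< {u} {w} u<w with <-cmp (lev u) (lev w)
    ... | tri< _ _ _   = refl
    ... | tri≈ u≮w _ _ = contradiction u<w u≮w
    ... | tri> u≮w _ _ = contradiction u<w u≮w

    share-≈ : ∀ {u w} → lev u ≡ lev w → share u w ≡ 2
    share-≈ {u} {w} u≈w with <-cmp (lev u) (lev w)
    ... | tri< _ u≉w _ = contradiction u≈w u≉w
    ... | tri≈ _ _ _   = refl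
    ... | tri> _ u≉w _ = contradiction u≈w u≉w

    share-> : ∀ {u w} → lev w < lev u → share u w ≡ upward u w
    share-> {u} {w} u>w with <-cmp (lev u) (lev w)
    ... | tri< _ _ u≯w = contradiction u>w u≯w
    ... | tri≈ _ _ u≯w = contradiction u>w u≯w
    ... | tri> _ _ _   = refl

    share-splits : ∀ u w → share u w + share w u ≡ 4
    share-splits u w with <-cmp (lev u) (lev w)
    ... | tri< u<w _ _ rewrite share-> {w} {u} u<w = m∸n+n≡m (upward-≤4 w u)
    ... | tri≈ _ u≈w _ rewrite share-≈ {w} {u} (≡.sym u≈w) = refl
    ... | tri> _ _ w<u rewrite share-< {w} {u} w<u = m+[n∸m]≡n (upward-≤4 u w)

    got : Fin n → ℕ
    got = weightAt G share

    <-levels : ∀ {u w k l} → lev u ≡ k → lev w ≡ l → k < l → lev u < lev w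
    <-levels refl refl k<l = k<l

    v-got : 8 ≤ got v
    v-got = two-nbrs {share v} {v} {x} {y} {4} {4} v~x v~y (proj₁ (proj₂ (proj₂ v-deg2)))
                     (≤-reflexive (≡.sym (to-level-1 v~x))) (≤-reflexive (≡.sym (to-level-1 v~y)))
      where
      to-level-1 : ∀ {p} → v ~ p → share v p ≡ 4
      to-level-1 {p} v~p = ≡-trans (share-< (<-levels lev-v (v~⇒lev≡1 v~p) (s≤s z≤n)))
                                   (cong (4 ∸_) (upward-at (v~⇒lev≡1 v~p)))

    -- Weight received on the levels 4, 3 and 2

    at-least : ∀ {k l u} → lev u ≡ k → l ≤ k → l ≤ lev u
    at-least refl l≤k = l≤k

    at-most : ∀ {k l u} → lev u ≡ k → k ≤ l → lev u ≤ l
    at-most refl k≤l = k≤l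

    1≤2 : 1 ≤ 2
    1≤2 = s≤s z≤n

    2≤3 : 2 ≤ 3
    2≤3 = s≤s (s≤s z≤n)

    3≤4 : 3 ≤ 4
    3≤4 = s≤s (s≤s (s≤s z≤n))

    nbr-level : ∀ {u w k} → lev u ≡ suc k → u ~ w →
                lev w ≡ k ⊎ lev w ≡ suc k ⊎ lev w ≡ suc (suc k)
    nbr-level lev-u u~w with m≤n⇒m<n∨m≡n (lev≥ u~w (at-least lev-u ≤-refl))
    ... | inj₂ k≡ = inj₁ (≡.sym k≡)
    ... | inj₁ k< = inj₂ (either-of-two k< (lev≤ u~w (at-most lev-u ≤-refl)))

    deg2-not-level-4 : ∀ {u a b} → Deg2 u a b → 2 ≤ lev u → 1 ≤ lev a → lev b ≢ 4
    deg2-not-level-4 d u≥2 a≥1 lev-b =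
      1+n≰n (≤-trans (at-least lev-b ≤-refl)
        (deg2-lev (deg2-flip d) u≥2 (at-least lev-b (≤-trans 1≤2 (≤-trans 2≤3 3≤4))) a≥1))

    share-above : ∀ {u p k} → lev u ≡ suc k → lev p ≡ k → share u p ≡ upwardAt (suc k) (owed (gift u) p)
    share-above lev-u lev-p = ≡-trans (share-> (<-levels lev-p lev-u ≤-refl)) (upward-at lev-u)

    share-below : ∀ {u w k} → lev u ≡ k → lev w ≡ suc k → share u w ≡ 4 ∸ upwardAt (suc k) (owed (gift w) u)
    share-below lev-u lev-w = ≡-trans (share-< (<-levels lev-u lev-w ≤-refl)) (cong (4 ∸_) (upward-at lev-w))

    share-level : ∀ {u w k} → lev u ≡ k → lev w ≡ k → share u w ≡ 2
    share-level lev-u lev-w = share-≈ (≡-trans lev-u (≡.sym lev-w))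

    -- An edge to level 3 brings 3, an edge within the level 2. So 3 + 3 or 3 + 2 + 2 is reached,
    -- unless `w` has degree two with a neighbour on level 4, which `deg2-lev` rules out.
    level-4 : ∀ {w} → lev w ≡ 4 → 6 ≤ got w
    level-4 {w} lev-w with parent lev-w
    ... | p , w~p , lev-p with other-neighbour w~p
    ...   | q , w~q , p≢q = from-second (third-neighbour w~p w~q p≢q) (lev-3-or-4 w~q)
      where
      lev-3-or-4 : ∀ {r} → w ~ r → lev r ≡ 3 ⊎ lev r ≡ 4
      lev-3-or-4 {r} w~r = either-of-two (lev≥ w~r (at-least lev-w ≤-refl)) (lev-≤4 r)
      share-3 : ∀ {r} → lev r ≡ 3 → 3 ≤ share w r
      share-3 lev-r = ≤-reflexive (≡.sym (share-above lev-w lev-r))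
      share-≥2 : ∀ {r} → lev r ≡ 3 ⊎ lev r ≡ 4 → 2 ≤ share w r
      share-≥2 (inj₁ lev-r) = ≤-trans 2≤3 (share-3 lev-r)
      share-≥2 (inj₂ lev-r) = ≤-reflexive (≡.sym (share-level lev-w lev-r))
      from-second : (∃ λ r → w ~ r × p ≢ r × q ≢ r) ⊎ Deg2 w p q → lev q ≡ 3 ⊎ lev q ≡ 4 → 6 ≤ got w
      from-second _ (inj₁ lev-q) = two-nbrs w~p w~q p≢q (share-3 lev-p) (share-3 lev-q)
      from-second (inj₁ (r , w~r , p≢r , q≢r)) (inj₂ lev-q) =
        ≤-trans (n≤1+n 6) (three-nbrs w~p w~q w~r p≢q p≢r q≢r
          (share-3 lev-p) (share-≥2 (inj₂ lev-q)) (share-≥2 (lev-3-or-4 w~r)))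
      from-second (inj₂ d) (inj₂ lev-q) = contradiction lev-q
        (deg2-not-level-4 d (at-least lev-w (≤-trans 2≤3 3≤4)) (at-least lev-p (≤-trans 1≤2 2≤3)))

    -- Without gifts an edge to level 2, 3 or 4 leaves `b` with 4, 2 or 1. The sums are 4 + 4, 4 + 2
    -- or, with a third neighbour, at least 4 + 1 + 1; degree two with a neighbour on level 4 is
    -- again impossible.
    level-3-kept : ∀ {b} → lev b ≡ 3 → 6 ≤ kept 0 b
    level-3-kept {b} lev-b with parent lev-b
    ... | a , b~a , lev-a with other-neighbour b~a
    ...   | q , b~q , a≢q = from-second (third-neighbour b~a b~q a≢q) (nbr-level lev-b b~q)
      where
      from-second : (∃ λ r → b ~ r × a ≢ r × q ≢ r) ⊎ Deg2 b a q →
                    lev q ≡ 2 ⊎ lev q ≡ 3 ⊎ lev q ≡ 4 → 6 ≤ kept 0 b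
      from-second _ (inj₁ lev-q) =
        ≤-trans (m≤m+n 6 2) (two-nbrs b~a b~q a≢q (keep-2 0 lev-a) (keep-2 0 lev-q))
      from-second _ (inj₂ (inj₁ lev-q)) = two-nbrs b~a b~q a≢q (keep-2 0 lev-a) (keep-3 0 lev-q)
      from-second (inj₁ (r , b~r , a≢r , q≢r)) (inj₂ (inj₂ lev-q)) =
        three-nbrs b~a b~q b~r a≢q a≢r q≢r (keep-2 0 lev-a) (keep-1 0 q z≤n) (keep-1 0 r z≤n)
      from-second (inj₂ d) (inj₂ (inj₂ lev-q)) = contradiction lev-q
        (deg2-not-level-4 d (at-least lev-b 2≤3) (at-least lev-a 1≤2))

    level-3 : ∀ {b} → lev b ≡ 3 → 6 ≤ got b
    level-3 {b} lev-b = ≤-trans (gift-kept b (level-3-kept lev-b)) (sum-mono-≤ keeps)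
      where
      keep≡share : ∀ {w} → b ~ w → keep (gift b) w ≡ share b w
      keep≡share {w} b~w with nbr-level lev-b b~w
      ... | inj₁ lev-w = ≡-trans (cong (λ l → keepAt l (owed (gift b) w)) lev-w)
                                 (≡.sym (share-above lev-b lev-w))
      ... | inj₂ (inj₁ lev-w) = ≡-trans (cong (λ l → keepAt l (owed (gift b) w)) lev-w)
                                        (≡.sym (share-level lev-b lev-w))
      ... | inj₂ (inj₂ lev-w) = ≡-trans (cong (λ l → keepAt l (owed (gift b) w)) lev-w)
                                        (≡.sym (share-below lev-b lev-w))
      keeps : ∀ w → 𝟙 (adj G b w) * keep (gift b) w ≤ 𝟙 (adj G b w) * share b w
      keeps w with b ~? w
      ... | yes b~w = *-monoʳ-≤ (𝟙 (adj G b w)) (≤-reflexive (keep≡share b~w))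
      ... | no  b≁w rewrite Bool.¬-not b≁w = z≤n

    -- The parent brings 4. As `z` is good, there is a second neighbour of level at most 2, and it
    -- brings at least 2.
    level-2-good : ∀ {z} → lev z ≡ 2 → ¬ Bad z → 6 ≤ got z
    level-2-good {z} lev-z good with parent lev-z
    ... | a , z~a , lev-a = from-second second
      where
      second : ∃ λ q → z ~ q × a ≢ q × lev q ≤ 2
      second with any? (λ q → (z ~? q) ×-dec ¬? (a ≟ᶠ q) ×-dec (lev q ≤? 2))
      ... | yes found = found
      ... | no  none  = contradiction
        (lev-z , λ (p , q , p≢q , z~p , z~q , p≤2 , q≤2) → p≢q (≡-trans (≡.sym (is-a z~p p≤2)) (is-a z~q q≤2)))
        good
        where
        is-a : ∀ {q} → z ~ q → lev q ≤ 2 → a ≡ q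
        is-a {q} z~q q≤2 = decidable-stable (a ≟ᶠ q) (λ a≢q → none (q , z~q , a≢q , q≤2))
      share-≥2 : ∀ {q} → z ~ q → lev q ≤ 2 → 2 ≤ share z q
      share-≥2 z~q q≤2 with either-of-two (lev≥ z~q (at-least lev-z ≤-refl)) q≤2
      ... | inj₁ lev-q = ≤-trans (s≤s (s≤s z≤n)) (≤-reflexive (≡.sym (share-above lev-z lev-q)))
      ... | inj₂ lev-q = ≤-reflexive (≡.sym (share-level lev-z lev-q))
      from-second : (∃ λ q → z ~ q × a ≢ q × lev q ≤ 2) → 6 ≤ got z
      from-second (q , z~q , a≢q , q≤2) =
        two-nbrs z~a z~q a≢q (≤-reflexive (≡.sym (share-above lev-z lev-a))) (share-≥2 z~q q≤2)

    -- Weight received by a bad vertex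

    module BadVertex {z} (bad : Bad z) where

      lev-z : lev z ≡ 2
      lev-z = proj₁ bad

      a : Fin n
      a = proj₁ (parent lev-z)

      z~a : z ~ a
      z~a = proj₁ (proj₂ (parent lev-z))

      lev-a : lev a ≡ 1
      lev-a = proj₂ (proj₂ (parent lev-z))

      -- The neighbour of `v` other than `a`.
      a′ : Fin n
      a′ = proj₁ (lev≡1⇒deg2 lev-a)

      v-nbrs : Deg2 v a a′
      v-nbrs = proj₂ (lev≡1⇒deg2 lev-a)

      lev-a′ : lev a′ ≡ 1
      lev-a′ = v~⇒lev≡1 (proj₁ (proj₂ v-nbrs))

      a≢a′ : a ≢ a′
      a≢a′ = proj₁ (proj₂ (proj₂ v-nbrs))

      at-a : ∀ {p} → z ~ p → lev p ≤ 2 → p ≡ a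
      at-a z~p p≤2 = bad-unique bad z~p z~a p≤2 (at-most lev-a 1≤2)

      child : ∀ {b} → z ~ b → a ≢ b → lev b ≡ 3
      child z~b a≢b with nbr-level lev-z z~b
      ... | inj₁ lev-b = contradiction (≡.sym (at-a z~b (at-most lev-b 1≤2))) a≢b
      ... | inj₂ (inj₁ lev-b) = contradiction (≡.sym (at-a z~b (at-most lev-b ≤-refl))) a≢b
      ... | inj₂ (inj₂ lev-b) = lev-b

      -- Keeps a walk that goes from `a` to a vertex of level at most 2 from continuing to `z`.
      no-other-way-up : ∀ {p} → z ~ p → lev p ≤ 2 → ¬ a ~ p
      no-other-way-up z~p p≤2 a~p = ~-irrefl (subst (a ~_) (at-a z~p p≤2) a~p)

      -- As `z` is bad, `b` keeps `4 ∸ gift b` of the edge and `z` gets the rest.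
      gift≤share : ∀ {b k} → lev b ≡ 3 → k ≤ gift b → k ≤ share z b
      gift≤share {b} lev-b k≤ = ≤-trans k≤ (≤-reflexive (≡.sym
        (≡-trans (share-below lev-z lev-b)
        (≡-trans (cong (λ k → 4 ∸ (4 ∸ k)) (owed-bad (gift b) bad))
                 (m∸[m∸n]≡n (≤-trans (gift-≤2 b) (≤-trans 2≤3 3≤4)))))))

      share-a : 4 ≤ share z a
      share-a = ≤-reflexive (≡.sym (share-above lev-z lev-a))

      level-2-or-3 : ∀ {b p} → lev b ≡ 3 → b ~ p → lev p ≤ 3 → lev p ≡ 2 ⊎ lev p ≡ 3
      level-2-or-3 lev-b b~p p≤3 = either-of-two (lev≥ b~p (at-least lev-b ≤-refl)) p≤3

      opaque
        -- The bypass of `v` runs along `a q r z` with `r` different from `a`, so `r` is a child of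
        -- `z`. Being adjacent to levels 1 and 3, `q` has level 2. These are `p` and `b`.
        first-child : ∃ λ b → ∃ λ p → z ~ b × a ≢ b × b ~ p × lev p ≡ 2 × z ≢ p
        first-child = B.r , B.q , ~-sym B.r~w , B.r≢a ∘ ≡.sym , ~-sym B.q~r , lev-q , B.q≢w ∘ ≡.sym
          where
          module B = Bypass (bypass v-nbrs (levs-≢ lev-z lev-v (λ ()))
                       (levs-≢ lev-z lev-a (λ ())) (levs-≢ lev-z lev-a′ (λ ())))
          lev-q : lev B.q ≡ 2
          lev-q = ≤-antisym (lev≤ B.a~q (at-most lev-a ≤-refl))
            (lev≥ (~-sym B.q~r) (at-least (child (~-sym B.r~w) (B.r≢a ∘ ≡.sym)) ≤-refl))

      opaque
        -- The bypass of `z` through `b` runs along `b q r a′` with `q` different from `z`. After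
        -- gifts of 2, `b` still keeps 2 for each of `z`, `p`, `q` if `q` has level 3. If `q` has
        -- level 2 it is good, and `b` keeps 2 and 4 for `z` and `q`.
        only-child : ∀ {b p} → Deg2 z a b → lev b ≡ 3 → b ~ p → lev p ≡ 2 → z ≢ p → 2 ≤ gift b
        only-child {b} {p} d@(_ , z~b , a≢b , _) lev-b b~p lev-p z≢p =
          gift-2 b (from-q (level-2-or-3 lev-b B.a~q (lev≤ (~-sym B.q~r) r≤2)))
          where
          -- In the first alternative `a` and `b` would be adjacent, although their levels are 1 and
          -- 3.
          a≁a′ : Triangles v → ¬ a ~ a′
          a≁a′ (inj₁ triangle) = contradiction
            (≤-trans (at-least lev-b ≤-refl) (lev≤ (triangle d) (at-most lev-a ≤-refl))) 1+n≰n
          a≁a′ (inj₂ ¬triangle) = ¬triangle v-nbrs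
          module B = Bypass (bypass (deg2-flip d) (levs-≢ lev-a′ lev-z (λ ()))
                       (levs-≢ lev-a′ lev-b (λ ())) (a≢a′ ∘ ≡.sym))
          r≤2 : lev B.r ≤ 2
          r≤2 = lev≤ (~-sym B.r~w) (at-most lev-a′ ≤-refl)
          -- The parent of a bad `q` is its only neighbour below level 3, so it would be `r`. Then
          -- `r` would be `a` or `a′`, yet it is adjacent to `a′`.
          q-good : lev B.q ≡ 2 → ¬ Bad B.q
          q-good lev-q q-bad with parent lev-q
          ... | r , q~r , lev-r
            with refl ← bad-unique q-bad q~r B.q~r (at-most lev-r 1≤2) r≤2
            with proj₂ (proj₂ (proj₂ v-nbrs)) r (proj₁ (proj₂ (lev≡1⇒deg2 lev-r)))
          ... | inj₁ r≡a  = a≁a′ triangles (subst (_~ a′) r≡a B.r~w)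
          ... | inj₂ r≡a′ = ~⇒≢ B.r~w r≡a′
          from-q : lev B.q ≡ 2 ⊎ lev B.q ≡ 3 → 6 ≤ kept 2 b
          from-q (inj₁ lev-q) = two-nbrs (~-sym z~b) B.a~q (B.q≢u ∘ ≡.sym)
                                  (keep-2 2 lev-z) (keep-2-good 2 lev-q (q-good lev-q))
          from-q (inj₂ lev-q) = three-nbrs (~-sym z~b) b~p B.a~q z≢p
                                  (B.q≢u ∘ ≡.sym) (levs-≢ lev-p lev-q (λ ()))
                                  (keep-2 2 lev-z) (keep-2 2 lev-p) (keep-3 2 lev-q)

      opaque
        -- The bypass of `v` runs along `a q r b`, where `r` differs from `z` and has level 2 or 3.
        -- After gifts of 1, `b` keeps 3 + 3 in the first case, and 3 + 2 + 1 in the second if it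
        -- has a third neighbour. Otherwise `b` has degree two, and `Triangles` decides.
        other-child : ∀ {b} → z ~ b → lev b ≡ 3 →
                      1 ≤ gift b ⊎ ∃ λ q → z ~ q × lev q ≡ 3 × 2 ≤ gift q
        other-child {b} z~b lev-b = from-q (level-2-or-3 lev-b b~q (lev≤ B.q~r q≤2))
          where
          module B = Bypass (bypass v-nbrs (levs-≢ lev-b lev-v (λ ()))
                       (levs-≢ lev-b lev-a (λ ())) (levs-≢ lev-b lev-a′ (λ ())))
          b~q : b ~ B.r
          b~q = ~-sym B.r~w
          q≤2 : lev B.q ≤ 2
          q≤2 = lev≤ B.a~q (at-most lev-a ≤-refl)
          z≢q : z ≢ B.r
          z≢q z≡r = no-other-way-up (subst (_~ B.q) (≡.sym z≡r) (~-sym B.q~r)) q≤2 B.a~q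
          from-deg2 : lev B.r ≡ 3 → Deg2 b z B.r → Triangles v → ∃ λ q → z ~ q × lev q ≡ 3 × 2 ≤ gift q
          -- Now `z`, `b` and `r` form a triangle, so `r` is a child of `z` too. A bypass from `r`
          -- to `a` yields a third neighbour of `r`, and even after gifts of 2 it keeps 2 on each of
          -- the three edges.
          from-deg2 lev-q d (inj₁ triangle) = B.r , triangle d , lev-q , gift-2 B.r
                (three-nbrs (~-sym (triangle d)) B.r~w C.a~q (levs-≢ lev-z lev-b (λ ()))
                   z≢p (C.q≢u ∘ ≡.sym) (keep-2 2 lev-z) (keep-3 2 lev-b)
                   (keep-≤3 2 ≤-refl (level-2-or-3 lev-q C.a~q (lev≤ (~-sym C.q~r) r≤2))))
            where
            module C = Bypass (bypass (deg2-flip d) (levs-≢ lev-a lev-b (λ ()))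
                         (levs-≢ lev-a lev-q (λ ())) (levs-≢ lev-a lev-z (λ ())))
            r≤2 : lev C.r ≤ 2
            r≤2 = lev≤ (~-sym C.r~w) (at-most lev-a ≤-refl)
            z≢p : z ≢ C.q
            z≢p z≡p = no-other-way-up (subst (_~ C.r) (≡.sym z≡p) C.q~r) r≤2 (~-sym C.r~w)
          -- The second vertex of a bypass from `z` to `v` has level at most 2, so it is `a`. The
          -- bypass then enters `v` through a neighbour of `a`, which must be `a′`: the excluded
          -- triangle.
          from-deg2 lev-q d (inj₂ ¬triangle) = contradiction
                (proj₂ (proj₂ (proj₂ v-nbrs)) C.r (~-sym C.r~w)) λ
                { (inj₁ r≡a) → ~⇒≢ a~r (≡.sym r≡a) ; (inj₂ r≡a′) → ¬triangle v-nbrs (subst (a ~_) r≡a′ a~r) }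
            where
            module C = Bypass (bypass d (levs-≢ lev-v lev-b (λ ()))
                         (levs-≢ lev-v lev-z (λ ())) (levs-≢ lev-v lev-q (λ ())))
            a~r : a ~ C.r
            a~r = subst (_~ C.r) (at-a C.a~q (lev≤ (~-sym C.q~r)
                    (at-most (v~⇒lev≡1 (~-sym C.r~w)) ≤-refl))) C.q~r
          from-q : lev B.r ≡ 2 ⊎ lev B.r ≡ 3 →
                   1 ≤ gift b ⊎ ∃ λ q → z ~ q × lev q ≡ 3 × 2 ≤ gift q
          from-q (inj₁ lev-q) = inj₁ (gift-1 b
            (two-nbrs (~-sym z~b) b~q z≢q (keep-2 1 lev-z) (keep-2 1 lev-q)))
          from-q (inj₂ lev-q) with third-neighbour (~-sym z~b) b~q z≢q
          ... | inj₁ (r , b~r , z≢r , q≢r) = inj₁ (gift-1 b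
            (three-nbrs (~-sym z~b) b~q b~r z≢q z≢r q≢r
              (keep-2 1 lev-z) (keep-3 1 lev-q) (keep-1 1 r (s≤s z≤n))))
          ... | inj₂ d = inj₂ (from-deg2 lev-q d triangles)

      -- Besides the 4 from `a`, one gift of 2 or two gifts of 1 are needed. The first child always
      -- gives 1, having both `z` and `p` on level 2.
      level-2-bad : 6 ≤ got z
      level-2-bad with first-child
      ... | b , p , z~b , a≢b , b~p , lev-p , z≢p = from-third (third-neighbour z~a z~b a≢b)
        where
        lev-b : lev b ≡ 3
        lev-b = child z~b a≢b
        b-gift : 1 ≤ gift b
        b-gift = gift-1 b (two-nbrs (~-sym z~b) b~p z≢p (keep-2 1 lev-z) (keep-2 1 lev-p))
        big-gift : ∀ {q} → z ~ q → lev q ≡ 3 → 2 ≤ gift q → 6 ≤ got z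
        big-gift z~q lev-q 2≤ = two-nbrs z~a z~q (levs-≢ lev-a lev-q (λ ())) share-a (gift≤share lev-q 2≤)
        from-third : (∃ λ r → z ~ r × a ≢ r × b ≢ r) ⊎ Deg2 z a b → 6 ≤ got z
        from-third (inj₂ d) = big-gift z~b lev-b (only-child d lev-b b~p lev-p z≢p)
        from-third (inj₁ (r , z~r , a≢r , b≢r)) with other-child z~r (child z~r a≢r)
        ... | inj₁ r-gift = three-nbrs z~a z~b z~r a≢b a≢r b≢r
                share-a (gift≤share lev-b b-gift) (gift≤share (child z~r a≢r) r-gift)
        ... | inj₂ (q , z~q , lev-q , 2≤) = big-gift z~q lev-q 2≤

    -- Adding up the weights

    others-got : ∀ {u} → u ≢ v → u ≢ x → u ≢ y → 6 ≤ got u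
    others-got {u} u≢v u≢x u≢y = at (lev u) refl (lev-≤4 u)
      where
      at : ∀ l → lev u ≡ l → l ≤ 4 → 6 ≤ got u
      at 0 lev-u _ = contradiction (lev≡0⇒v lev-u) u≢v
      at 1 lev-u _ with proj₂ (proj₂ (proj₂ v-deg2)) u (proj₁ (proj₂ (lev≡1⇒deg2 lev-u)))
      ... | inj₁ u≡x = contradiction u≡x u≢x
      ... | inj₂ u≡y = contradiction u≡y u≢y
      at 2 lev-u _ with bad? u
      ... | yes bad  = BadVertex.level-2-bad bad
      ... | no  good = level-2-good lev-u good
      at 3 lev-u _ = level-3 lev-u
      at 4 lev-u _ = level-4 lev-u
      at (suc (suc (suc (suc (suc _))))) _ (s≤s (s≤s (s≤s (s≤s ()))))

    -- With a credit of 6 for each of `x` and `y`, every vertex has 6 and `v` has 8. This gives 6n +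
    -- 2 ≤ 4e + 12, where 2 is cancelled before halving.
    edges-bound : 3 * n ≤ 2 * numEdges G + 5
    edges-bound = *-cancelˡ-≤ 2 (+-cancelʳ-≤ 2 _ _ (begin
      2 * (3 * n) + 2
        ≡⟨ cong₂ _+_ (≡.sym six) (≡.sym (cong (2 *_) (sum-indicator v))) ⟩
      sum {n} (λ _ → 6) + 2 * sum ⟦ v ⟧
        ≡⟨ cong (sum {n} (λ _ → 6) +_) (sum-*ˡ 2 ⟦ v ⟧) ⟨
      sum {n} (λ _ → 6) + sum (λ u → 2 * ⟦ v ⟧ u)
        ≡⟨ ∑-distrib-+ (λ _ → 6) (λ u → 2 * ⟦ v ⟧ u) ⟨
      sum (λ u → 6 + 2 * ⟦ v ⟧ u)
        ≤⟨ sum-mono-≤ enough ⟩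
      sum (λ u → got u + 6 * (⟦ x ⟧ u + ⟦ y ⟧ u))
        ≡⟨ ∑-distrib-+ got (λ u → 6 * (⟦ x ⟧ u + ⟦ y ⟧ u)) ⟩
      sum got + sum (λ u → 6 * (⟦ x ⟧ u + ⟦ y ⟧ u))
        ≡⟨ cong₂ _+_ (weighted-handshake G share 4 share-splits) twelve ⟩
      4 * numEdges G + 12
        ≡⟨ regroup (numEdges G) ⟩
      2 * (2 * numEdges G + 5) + 2 ∎))
      where
      open ≤-Reasoning
      ⟦_⟧ : Fin n → Fin n → ℕ
      ⟦ a ⟧ u = 𝟙 (does (u ≟ᶠ a))
      six : sum {n} (λ _ → 6) ≡ 2 * (3 * n)
      six = ≡-trans (sum-const n 6) (≡-trans (*-comm n 6) (*-assoc 2 3 n))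
      twelve : sum (λ u → 6 * (⟦ x ⟧ u + ⟦ y ⟧ u)) ≡ 12
      twelve = ≡-trans (sum-*ˡ 6 (λ u → ⟦ x ⟧ u + ⟦ y ⟧ u)) (cong (6 *_)
        (≡-trans (∑-distrib-+ ⟦ x ⟧ ⟦ y ⟧) (cong₂ _+_ (sum-indicator x) (sum-indicator y))))
      regroup : ∀ e → 4 * e + 12 ≡ 2 * (2 * e + 5) + 2
      regroup = solve-∀
      enough : ∀ u → 6 + 2 * ⟦ v ⟧ u ≤ got u + 6 * (⟦ x ⟧ u + ⟦ y ⟧ u)
      enough u with u ≟ᶠ v | u ≟ᶠ x | u ≟ᶠ y
      ... | yes refl | _ | _ = ≤-trans v-got (m≤m+n _ _)
      ... | no _ | yes _ | _ = ≤-trans (*-monoʳ-≤ 6 (m≤m+n 1 _)) (m≤n+m _ (got u))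
      ... | no _ | no _ | yes _ = m≤n+m 6 (got u)
      ... | no u≢v | no u≢x | no u≢y = ≤-trans (others-got u≢v u≢x u≢y) (m≤m+n _ _)

  min-degree-3 : (∀ u a b → ¬ Deg2 u a b) → 3 * n ≤ 2 * numEdges G
  min-degree-3 none = begin
    3 * n                      ≡⟨ *-comm 3 n ⟩
    n * 3                      ≡⟨ sum-const n 3 ⟨
    sum {n} (λ _ → 3)          ≤⟨ sum-mono-≤ three ⟩
    sum (nbrSum (λ _ → 1))     ≡⟨ weighted-handshake G (λ _ _ → 1) 2 (λ _ _ → refl) ⟩
    2 * numEdges G             ∎
    where
    open ≤-Reasoning
    three : ∀ u → 3 ≤ nbrSum (λ _ → 1) u
    three u with two-neighbours u
    ... | a , b , u~a , u~b , a≢b with third-neighbour u~a u~b a≢b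
    ...   | inj₂ d = contradiction d (none u a b)
    ...   | inj₁ (r , u~r , a≢r , b≢r) = three-nbrs u~a u~b u~r a≢b a≢r b≢r ≤-refl ≤-refl ≤-refl

  lower-bound : 3 * n ≤ 2 * numEdges G + 5
  lower-bound
    with any? (λ u → any? λ a → any? λ b → deg2? u a b ×-dec ¬? (a ~? b))
  ... | yes (v , x , y , d@(_ , _ , _ , only) , x≁y) = Rooted.edges-bound d (inj₂ apart)
    where
    apart : ∀ {a b} → Deg2 v a b → ¬ a ~ b
    apart {a} {b} (v~a , v~b , _ , _) a~b with only a v~a | only b v~b
    ... | inj₁ refl | inj₁ refl = ~-irrefl a~b
    ... | inj₁ refl | inj₂ refl = x≁y a~b
    ... | inj₂ refl | inj₁ refl = x≁y (~-sym a~b)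
    ... | inj₂ refl | inj₂ refl = ~-irrefl a~b
  ... | no all-triangles with any? (λ u → any? λ a → any? λ b → deg2? u a b)
  ...   | yes (v , x , y , d) = Rooted.edges-bound d (inj₁ λ {u} {a} {b} e →
            decidable-stable (a ~? b) (λ a≁b → all-triangles (u , a , b , e , a≁b)))
  ...   | no none = ≤-trans (min-degree-3 (λ u a b d → none (u , a , b , d))) (m≤m+n _ 5)

-- The upper bound

-- Unlike from-yes, this only makes the type checker evaluate the Boolean part of the decision.
witness : ∀ {P : Set} (P? : Dec P) → does P? ≡ true → P
witness (yes p) _ = p

-- All pages have the same neighbours, so adjacency factors through the quotient that merges them.
-- Statements for every `n` become finite checks on twelve kinds.
Kind : Set
Kind = Fin 12

page : Kind
page = # 11

kindEdges : List (ℕ × ℕ)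
kindEdges = (0 , 1) ∷ (0 , 2) ∷ (0 , 3) ∷ (0 , 4) ∷ (2 , 3) ∷ (2 , 4) ∷ (3 , 4)
          ∷ (2 , 5) ∷ (2 , 6) ∷ (5 , 6) ∷ (3 , 7) ∷ (3 , 8) ∷ (7 , 8) ∷ (4 , 9) ∷ (4 , 10) ∷ (9 , 10)
          ∷ (0 , 11) ∷ (1 , 11) ∷ []

listed : ℕ → ℕ → Bool
listed k l = any (λ (p , q) → (k ≡ᵇ p) ∧ (l ≡ᵇ q)) kindEdges

joined : Kind → Kind → Bool
joined a b = listed (toℕ a) (toℕ b) ∨ listed (toℕ b) (toℕ a)

joined-sym : ∀ a b → joined a b ≡ joined b a
joined-sym a b = Bool.∨-comm (listed (toℕ a) (toℕ b)) (listed (toℕ b) (toℕ a))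

Joined : Kind → Kind → Set
Joined a b = joined a b ≡ true

-- The vertices 0, …, 10 have different kinds; all further vertices are pages.
kind : ∀ {n} → Fin n → Kind
kind i = fromℕ< (s≤s (m⊓n≤m 11 (toℕ i)))

opaque
  joined-irrefl : ∀ a → joined a a ≡ false
  joined-irrefl = from-yes (all? λ a → joined a a Bool.≟ false)

  -- Excludes pentagons: a kind other than `page` belongs to a single vertex, so repeating it
  -- repeats a vertex. The five pairs are the nonconsecutive ones, and testing each edge at once
  -- prunes the enumeration.
  closed-5-walk-repeats : ∀ a b → Joined a b → ∀ c → Joined b c → ∀ d → Joined c d →
    ∀ e → Joined d e → Joined e a →
    (a ≡ c × a ≢ page) ⊎ (a ≡ d × a ≢ page) ⊎ (b ≡ d × b ≢ page) ⊎
    (b ≡ e × b ≢ page) ⊎ (c ≡ e × c ≢ page)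
  closed-5-walk-repeats = from-yes
    (all? λ a → all? λ b → joined? a b →-dec (all? λ c → joined? b c →-dec
      (all? λ d → joined? c d →-dec (all? λ e → joined? d e →-dec (joined? e a →-dec
        (repeats? a c ⊎-dec repeats? a d ⊎-dec repeats? b d ⊎-dec repeats? b e ⊎-dec repeats? c e))))))
    where
    joined? : ∀ a b → Dec (Joined a b)
    joined? a b = joined a b Bool.≟ true
    repeats? : ∀ a b → Dec (a ≡ b × a ≢ page)
    repeats? a b = (a ≟ᶠ b) ×-dec ¬? (a ≟ᶠ page)

-- The graph on fifteen vertices, by enumeration

module Template where

  V : Set
  V = Fin 15

  Link : V → V → Set
  Link s t = Joined (kind s) (kind t)

  link? : ∀ s t → Dec (Link s t)
  link? s t = joined (kind s) (kind t) Bool.≟ true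

  -- Vertices and edges alternate, so that the search in `route?` drops a prefix at the first
  -- missing edge.
  Route : (V → V → Set) → V → V → Set
  Route E a b = ∃ λ p → E a p × ∃ λ q → E p q × ∃ λ r → E q r × E r b × Unique (a ∷ p ∷ q ∷ r ∷ b ∷ [])

  route? : ∀ {E : V → V → Set} → (∀ s t → Dec (E s t)) → ∀ a b → Dec (Route E a b)
  route? E? a b = any? λ p → E? a p ×-dec any? λ q → E? p q ×-dec any? λ r → E? q r ×-dec E? r b
    ×-dec AllPairs.allPairs? (λ s t → ¬? (s ≟ᶠ t)) (a ∷ p ∷ q ∷ r ∷ b ∷ [])

  LinkOff : V → V → V → V → Set
  LinkOff s t p q = Link p q × ¬ (s ≡ p × t ≡ q) × ¬ (s ≡ q × t ≡ p)

  linkOff? : ∀ s t p q → Dec (LinkOff s t p q)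
  linkOff? s t p q = link? p q ×-dec ¬? ((s ≟ᶠ p) ×-dec (t ≟ᶠ q)) ×-dec ¬? ((s ≟ᶠ q) ×-dec (t ≟ᶠ p))

  -- Asking for a detour around each edge of one route replaces the quantification over all colours
  -- by a finite condition.
  Bypassed : V → V → V → V → Set
  Bypassed a b s t = Link s t × Route (LinkOff s t) a b

  opaque
    routes : ∀ a b → a ≢ b → ¬ Link a b → Route (Bypassed a b) a b
    routes = witness (all? λ a → all? λ b → ¬? (a ≟ᶠ b) →-dec (¬? (link? a b) →-dec
      route? (λ s t → link? s t ×-dec route? (linkOff? s t) a b) a b)) refl

toℕ-kind : ∀ {n} (i : Fin n) → toℕ (kind i) ≡ 11 ⊓ toℕ i
toℕ-kind i = toℕ-fromℕ< (s≤s (m⊓n≤m 11 (toℕ i)))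

kind-core : ∀ {n} {i : Fin n} → toℕ i < 11 → toℕ (kind i) ≡ toℕ i
kind-core {i = i} i<11 = ≡-trans (toℕ-kind i) (m≥n⇒m⊓n≡n (<⇒≤ i<11))

kind-page : ∀ {n} {i : Fin n} → 11 ≤ toℕ i → kind i ≡ page
kind-page {i = i} 11≤i = toℕ-injective (≡-trans (toℕ-kind i) (m≤n⇒m⊓n≡m 11≤i))

kind-≢page : ∀ {n} {i : Fin n} → kind i ≢ page → toℕ i < 11
kind-≢page {i = i} ≢page with toℕ i <? 11
... | yes i<11 = i<11
... | no  i≮11 = contradiction (kind-page (≮⇒≥ i≮11)) ≢page

kind-≡ : ∀ {m n} {i : Fin m} {j : Fin n} → toℕ i ≡ toℕ j → kind i ≡ kind j
kind-≡ {i = i} {j} i≡j = toℕ-injective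
  (≡-trans (toℕ-kind i) (≡-trans (cong (11 ⊓_) i≡j) (≡.sym (toℕ-kind j))))

kind-injective : ∀ {n} {i j : Fin n} → kind i ≡ kind j → kind i ≢ page → i ≡ j
kind-injective {i = i} {j} same ≢page = toℕ-injective
  (≡-trans (≡.sym (kind-core (kind-≢page ≢page)))
  (≡-trans (cong toℕ same) (kind-core (kind-≢page (≢page ∘ ≡-trans same)))))

-- Distinct colours and the edges of the pentagon

module _ {n : ℕ} where

  orderedCode : Fin n → Fin n → ℕ
  orderedCode i j = toℕ (combine i j)

  -- Putting the smaller end first makes the code depend on the unordered pair only, so different
  -- edges get different colours.
  pairCode : Fin n → Fin n → ℕ
  pairCode i j = if toℕ i <ᵇ toℕ j then orderedCode i j else orderedCode j i

  SamePair : Fin n → Fin n → Fin n → Fin n → Set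
  SamePair i j k l = (i ≡ k × j ≡ l) ⊎ (i ≡ l × j ≡ k)

  pairCode-injective : ∀ i j k l → pairCode i j ≡ pairCode k l → SamePair i j k l
  pairCode-injective i j k l same with toℕ i <ᵇ toℕ j | toℕ k <ᵇ toℕ l
  ... | true  | true  = inj₁ (combine-injective i j k l (toℕ-injective same))
  ... | true  | false = inj₂ (combine-injective i j l k (toℕ-injective same))
  ... | false | true  = inj₂ (Data.Product.swap (combine-injective j i k l (toℕ-injective same)))
  ... | false | false = inj₁ (Data.Product.swap (combine-injective j i l k (toℕ-injective same)))

  pairCode-sym : ∀ i j → pairCode i j ≡ pairCode j i
  pairCode-sym i j with <-cmp (toℕ i) (toℕ j)
  ... | tri≈ _ i≡j _ rewrite toℕ-injective i≡j = refl
  ... | tri< i<j _ j≮i rewrite <ᵇ-true i<j | <ᵇ-false j≮i = refl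
  ... | tri> i≮j _ j<i rewrite <ᵇ-true j<i | <ᵇ-false i≮j = refl

-- Separates the four edges of a path from the edge between 0 and 4, which becomes the added one.
data CycleEdge : Fin 5 → Fin 5 → Set where
  forwards  : ∀ i → CycleEdge (inject₁ i) (suc i)
  backwards : ∀ i → CycleEdge (suc i) (inject₁ i)
  closing   : CycleEdge 0F 4F
  closing′  : CycleEdge 4F 0F

cycleEdge : ∀ a b → Cycle5 a b → CycleEdge a b
cycleEdge 0F 1F _ = forwards 0F
cycleEdge 1F 2F _ = forwards 1F
cycleEdge 2F 3F _ = forwards 2F
cycleEdge 3F 4F _ = forwards 3F
cycleEdge 1F 0F _ = backwards 0F
cycleEdge 2F 1F _ = backwards 1F
cycleEdge 3F 2F _ = backwards 2F
cycleEdge 4F 3F _ = backwards 3F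
cycleEdge 0F 4F _ = closing
cycleEdge 4F 0F _ = closing′
cycleEdge 0F 0F ()
cycleEdge 0F 2F ()
cycleEdge 0F 3F ()
cycleEdge 1F 1F ()
cycleEdge 1F 3F ()
cycleEdge 1F 4F ()
cycleEdge 2F 0F ()
cycleEdge 2F 2F ()
cycleEdge 2F 4F ()
cycleEdge 3F 0F ()
cycleEdge 3F 1F ()
cycleEdge 3F 3F ()
cycleEdge 4F 1F ()
cycleEdge 4F 2F ()
cycleEdge 4F 4F ()

transpose-target : ∀ {n} (i j : Fin n) → transpose i j j ≡ i
transpose-target i j with j ≟ᶠ i
... | yes j≡i = j≡i
... | no  _ with j ≟ᶠ j
...   | yes _   = refl
...   | no  j≢j = contradiction refl j≢j

transpose-fixed : ∀ {n} {i j l : Fin n} → l ≢ i → l ≢ j → transpose i j l ≡ l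
transpose-fixed {i = i} {j} {l} l≢i l≢j
  rewrite dec-false (l ≟ᶠ i) l≢i | dec-false (l ≟ᶠ j) l≢j = refl

-- The number of neighbours with a smaller number. The default 2 covers vertex 10, with neighbours 4
-- and 9, and the pages, with neighbours 0 and 1.
backDegree : ℕ → ℕ
backDegree 0  = 0
backDegree 1  = 1
backDegree 2  = 1
backDegree 3  = 2
backDegree 4  = 3
backDegree 5  = 1
backDegree 6  = 2
backDegree 7  = 1
backDegree 8  = 2
backDegree 9  = 1
backDegree _  = 2

-- The graph on 15 + k vertices

module Construction (k : ℕ) where

  N : ℕ
  N = 15 + k

  graph : Graph N
  graph = record
    { adj = λ i j → joined (kind i) (kind j)
    ; sym = λ i j → joined-sym (kind i) (kind j)
    ; irrefl = λ i → joined-irrefl (kind i)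
    }

  colouring : Colouring N
  colouring = record { col = pairCode ; colSym = pairCode-sym }

  open Paths graph colouring

  free : RainbowFree (cycleAdj 5) graph colouring
  free (φ , φ-inj , φ-adj , _)
    with closed-5-walk-repeats (kind (φ 0F)) (kind (φ 1F)) (φ-adj 0F 1F refl)
           (kind (φ 2F)) (φ-adj 1F 2F refl) (kind (φ 3F)) (φ-adj 2F 3F refl)
           (kind (φ 4F)) (φ-adj 3F 4F refl) (φ-adj 4F 0F refl)
  ... | inj₁ (same , ≢page) with () ← φ-inj (kind-injective same ≢page)
  ... | inj₂ (inj₁ (same , ≢page)) with () ← φ-inj (kind-injective same ≢page)
  ... | inj₂ (inj₂ (inj₁ (same , ≢page))) with () ← φ-inj (kind-injective same ≢page)
  ... | inj₂ (inj₂ (inj₂ (inj₁ (same , ≢page)))) with () ← φ-inj (kind-injective same ≢page)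
  ... | inj₂ (inj₂ (inj₂ (inj₂ (same , ≢page)))) with () ← φ-inj (kind-injective same ≢page)

  -- The path edges differ in colour because `pairCode` is injective on unordered pairs, and the
  -- closing edge differs from them because they avoid `α`.
  closing-copy : ∀ (φ : Fin 5 → Fin N) α → Injective _≡_ _≡_ φ →
    (∀ i → φ (inject₁ i) ~ φ (suc i)) → (∀ i → pairCode (φ (inject₁ i)) (φ (suc i)) ≢ α) →
    RainbowCopy (cycleAdj 5) (addAdj (adj graph) (φ 0F) (φ 4F)) (addCol pairCode (φ 0F) (φ 4F) α)
  closing-copy φ α φ-inj linked avoids =
    φ , (λ {_} {_} → φ-inj) , (λ a b ab → new-adj (cycleEdge a b ab)) ,
    λ a b c d ab cd → rainbow (cycleEdge a b ab) (cycleEdge c d cd)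
    where
    A′ : Fin N → Fin N → Bool
    A′ = addAdj (adj graph) (φ 0F) (φ 4F)
    C′ : Fin N → Fin N → ℕ
    C′ = addCol pairCode (φ 0F) (φ 4F) α

    Inner : Fin 5 → Fin 5 → Set
    Inner a b = ¬ (a ≡ 0F × b ≡ 4F) × ¬ (a ≡ 4F × b ≡ 0F)

    inner : ∀ i → Inner (inject₁ i) (suc i)
    inner 0F = (λ ()) , (λ ())
    inner 1F = (λ ()) , (λ ())
    inner 2F = (λ ()) , (λ ())
    inner 3F = (λ ()) , (λ ())

    old-adj : ∀ {a b} → Inner a b → A′ (φ a) (φ b) ≡ adj graph (φ a) (φ b)
    old-adj (≢₁ , ≢₂) = addAdj-old (φ 0F) (φ 4F) (adj graph)
      (λ (e , f) → ≢₁ (φ-inj e , φ-inj f)) (λ (e , f) → ≢₂ (φ-inj e , φ-inj f))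

    old-col : ∀ {a b} → Inner a b → C′ (φ a) (φ b) ≡ pairCode (φ a) (φ b)
    old-col (≢₁ , ≢₂) = addCol-old (φ 0F) (φ 4F) pairCode α
      (λ (e , f) → ≢₁ (φ-inj e , φ-inj f)) (λ (e , f) → ≢₂ (φ-inj e , φ-inj f))

    A′-sym : ∀ a b → A′ (φ a) (φ b) ≡ A′ (φ b) (φ a)
    A′-sym a b = addAdj-sym (φ 0F) (φ 4F) (adj graph) (Graph.sym graph) (φ a) (φ b)

    C′-sym : ∀ a b → C′ (φ a) (φ b) ≡ C′ (φ b) (φ a)
    C′-sym a b = addCol-sym (φ 0F) (φ 4F) pairCode α pairCode-sym (φ a) (φ b)

    new-adj : ∀ {a b} → CycleEdge a b → A′ (φ a) (φ b) ≡ true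
    new-adj (forwards i)  = ≡-trans (old-adj (inner i)) (linked i)
    new-adj (backwards i) = ≡-trans (A′-sym (suc i) (inject₁ i)) (≡-trans (old-adj (inner i)) (linked i))
    new-adj closing  = addAdj-new (φ 0F) (φ 4F) (adj graph)
    new-adj closing′ = ≡-trans (A′-sym 4F 0F) (addAdj-new (φ 0F) (φ 4F) (adj graph))

    data Colour (a b : Fin 5) : Set where
      new : SamePair a b 0F 4F → C′ (φ a) (φ b) ≡ α → Colour a b
      old : C′ (φ a) (φ b) ≡ pairCode (φ a) (φ b) → pairCode (φ a) (φ b) ≢ α → Colour a b

    colour : ∀ {a b} → CycleEdge a b → Colour a b
    colour (forwards i)  = old (old-col (inner i)) (avoids i)
    colour (backwards i) = old
      (≡-trans (C′-sym (suc i) (inject₁ i)) (≡-trans (old-col (inner i)) (pairCode-sym (φ (inject₁ i)) (φ (suc i)))))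
      (λ same → avoids i (≡-trans (pairCode-sym (φ (inject₁ i)) (φ (suc i))) same))
    colour closing  = new (inj₁ (refl , refl)) (addCol-new (φ 0F) (φ 4F) pairCode α)
    colour closing′ = new (inj₂ (refl , refl))
      (≡-trans (C′-sym 4F 0F) (addCol-new (φ 0F) (φ 4F) pairCode α))

    rainbow : ∀ {a b c d} → CycleEdge a b → CycleEdge c d →
              ¬ (a ≡ c × b ≡ d) → ¬ (a ≡ d × b ≡ c) → ¬ C′ (φ a) (φ b) ≡ C′ (φ c) (φ d)
    rainbow ab cd ≢₁ ≢₂ same with colour ab | colour cd
    ... | new (inj₁ (refl , refl)) _ | new (inj₁ (refl , refl)) _ = ≢₁ (refl , refl)
    ... | new (inj₁ (refl , refl)) _ | new (inj₂ (refl , refl)) _ = ≢₂ (refl , refl)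
    ... | new (inj₂ (refl , refl)) _ | new (inj₁ (refl , refl)) _ = ≢₂ (refl , refl)
    ... | new (inj₂ (refl , refl)) _ | new (inj₂ (refl , refl)) _ = ≢₁ (refl , refl)
    ... | new _ ab-α | old cd-old cd≢α = cd≢α (≡-trans (≡.sym cd-old) (≡-trans (≡.sym same) ab-α))
    ... | old ab-old ab≢α | new _ cd-α = ab≢α (≡-trans (≡.sym ab-old) (≡-trans same cd-α))
    ... | old ab-old _ | old cd-old _
      with pairCode-injective _ _ _ _ (≡-trans (≡.sym ab-old) (≡-trans same cd-old))
    ...   | inj₁ (e , f) = ≢₁ (φ-inj e , φ-inj f)
    ...   | inj₂ (e , f) = ≢₂ (φ-inj e , φ-inj f)

  -- Copies of the fifteen-vertex graph

  open Template

  record Embedding : Set where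
    field
      ψ : V → Fin N
      ψ-injective : Injective _≡_ _≡_ ψ
      ψ-kind : ∀ i → kind (ψ i) ≡ kind i
  open Embedding

  inclusion : Embedding
  inclusion = record
    { ψ = _↑ˡ k
    ; ψ-injective = ↑ˡ-injective k _ _
    ; ψ-kind = λ i → kind-≡ (toℕ-↑ˡ i k)
    }

  transpose-kind : ∀ {i j : Fin N} → kind i ≡ kind j → ∀ l → kind (transpose i j l) ≡ kind l
  transpose-kind {i} {j} same l with l ≟ᶠ i
  ... | yes refl = ≡.sym same
  ... | no  _ with l ≟ᶠ j
  ...   | yes refl = same
  ...   | no  _    = refl

  -- Transposing two vertices of the same kind preserves kinds and hence adjacency; here it moves
  -- the image of `t` to `w`.
  redirect : Embedding → (t : V) (w : Fin N) → kind w ≡ kind t → Embedding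
  redirect f t w same = record
    { ψ = transpose w (ψ f t) ∘ ψ f
    ; ψ-injective = λ e → ψ-injective f (≡-trans (≡.sym (transpose-inverse (ψ f t) w))
        (≡-trans (cong (transpose (ψ f t) w) e) (transpose-inverse (ψ f t) w)))
    ; ψ-kind = λ i → ≡-trans (transpose-kind (≡-trans same (≡.sym (ψ-kind f t))) (ψ f i)) (ψ-kind f i)
    }

  -- The template page 14 stays reserved for a second vertex; a first page is hit by 13.
  Hits : Fin N → Set
  Hits u = ∃ λ (f : Embedding) → ∃ λ a → ψ f a ≡ u × a ≢ # 14

  -- Outside the pages a kind has one vertex, so every embedding preserves its number.
  core-vertex : ∀ (f : Embedding) {u : Fin N} → toℕ u < 11 → ∃ λ a → ψ f a ≡ u × a ≢ # 14
  core-vertex f {u} u<11 = a , ≡.sym (kind-injective (≡.sym (≡-trans (ψ-kind f a) (kind-≡ a≡u))) u≢page) ,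
    λ a≡14 → <⇒≱ u<11 (≤-trans (m≤m+n 11 3)
      (≤-reflexive (≡-trans (cong toℕ (≡.sym a≡14)) a≡u)))
    where
    a : V
    a = fromℕ< (≤-trans u<11 (m≤m+n 11 4))
    a≡u : toℕ a ≡ toℕ u
    a≡u = toℕ-fromℕ< _
    u≢page : kind u ≢ page
    u≢page u-page = <⇒≢ u<11 (≡-trans (≡.sym (kind-core u<11)) (cong toℕ u-page))

  hit : ∀ u → Hits u
  hit u with toℕ u <? 11
  ... | yes u<11 = inclusion , core-vertex inclusion u<11
  ... | no  u≮11 = redirect inclusion (# 13) u (kind-page (≮⇒≥ u≮11)) , # 13 ,
                   transpose-target u (ψ inclusion (# 13)) , λ ()

  hit-two : ∀ {u w} → u ≢ w → ∃ λ (f : Embedding) → ∃ λ a → ∃ λ b → ψ f a ≡ u × ψ f b ≡ w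
  hit-two {u} {w} u≢w with hit u | toℕ w <? 11
  ... | f , a , a↦u , _ | yes w<11 with core-vertex f w<11
  ...   | b , b↦w , _ = f , a , b , a↦u , b↦w
  -- The transposition moves only `w` and the image of 14, so `u` stays where it is.
  hit-two {u} {w} u≢w | f , a , a↦u , a≢14 | no w≮11 =
    redirect f (# 14) w (kind-page (≮⇒≥ w≮11)) , a , # 14 ,
    ≡-trans (transpose-fixed (u≢w ∘ ≡-trans (≡.sym a↦u)) (a≢14 ∘ ψ-injective f)) a↦u ,
    transpose-target w (ψ f (# 14))

  module _ (f : Embedding) where

    edgeColour : V → V → ℕ
    edgeColour s t = pairCode (ψ f s) (ψ f t)

    Avoiding : ℕ → V → V → Set
    Avoiding α p q = Link p q × edgeColour p q ≢ α

    link⇒~ : ∀ {s t} → Link s t → ψ f s ~ ψ f t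
    link⇒~ {s} {t} = ≡-trans (cong₂ joined (ψ-kind f s) (ψ-kind f t))

    route-map : ∀ {E E′ : V → V → Set} → (∀ {s t} → E s t → E′ s t) → ∀ {a b} → Route E a b → Route E′ a b
    route-map g (p , ap , q , pq , r , qr , rb , distinct) = p , g ap , q , g pq , r , g qr , g rb , distinct

    off⇒avoiding : ∀ {s t p q} → LinkOff s t p q → Avoiding (edgeColour s t) p q
    off⇒avoiding {s} {t} {p} {q} (pq , ≢₁ , ≢₂) = pq , λ same →
      [ (λ (e , h) → ≢₁ (ψ-injective f (≡.sym e) , ψ-injective f (≡.sym h)))
      , (λ (e , h) → ≢₂ (ψ-injective f (≡.sym h) , ψ-injective f (≡.sym e))) ]
        (pairCode-injective (ψ f p) (ψ f q) (ψ f s) (ψ f t) same)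

    -- If α occurs on the first route, then only on one edge, and that edge is bypassed by another route.
    avoiding-route : ∀ α {a b} → Route (Bypassed a b) a b → Route (Avoiding α) a b
    avoiding-route α {a} {b} (p , (ap , ap′) , q , (pq , pq′) , r , (qr , qr′) , (rb , rb′) , distinct)
      with edgeColour a p ≟ α | edgeColour p q ≟ α | edgeColour q r ≟ α | edgeColour r b ≟ α
    ... | yes refl | _ | _ | _ = route-map off⇒avoiding ap′
    ... | no _ | yes refl | _ | _ = route-map off⇒avoiding pq′
    ... | no _ | no _ | yes refl | _ = route-map off⇒avoiding qr′
    ... | no _ | no _ | no _ | yes refl = route-map off⇒avoiding rb′
    ... | no ap≢α | no pq≢α | no qr≢α | no rb≢α =
      p , (ap , ap≢α) , q , (pq , pq≢α) , r , (qr , qr≢α) , (rb , rb≢α) , distinct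

    route⇒copy : ∀ α {a b} → Route (Avoiding α) a b →
      RainbowCopy (cycleAdj 5) (addAdj (adj graph) (ψ f a) (ψ f b)) (addCol pairCode (ψ f a) (ψ f b) α)
    route⇒copy α {a} {b} (p , ap , q , pq , r , qr , rb , distinct) =
      closing-copy (ψ f ∘ lookup route) α (lookup-injective distinct _ _ ∘ ψ-injective f)
        (λ i → link⇒~ (proj₁ (edge i))) (λ i → proj₂ (edge i))
      where
      route : Vec V 5
      route = a ∷ p ∷ q ∷ r ∷ b ∷ []
      edge : ∀ i → Avoiding α (lookup route (inject₁ i)) (lookup route (suc i))
      edge 0F = ap
      edge 1F = pq
      edge 2F = qr
      edge 3F = rb

  saturated : RainbowSaturated (cycleAdj 5) graph colouring
  saturated = free , λ u w u≢w u≁w α → complete α u≢w u≁w (hit-two u≢w)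
    where
    complete : ∀ α {u w} → u ≢ w → adj graph u w ≡ false →
      (∃ λ (f : Embedding) → ∃ λ a → ∃ λ b → ψ f a ≡ u × ψ f b ≡ w) →
      RainbowCopy (cycleAdj 5) (addAdj (adj graph) u w) (addCol pairCode u w α)
    complete α u≢w u≁w (f , a , b , refl , refl) = route⇒copy f α (avoiding-route f α
      (routes a b (u≢w ∘ cong (ψ f)) (λ ab → contradiction (≡-trans (≡.sym (link⇒~ f ab)) u≁w) λ ())))

  -- Counting the edges

  new-edges : ∀ (j : Fin N) → sum (λ i → forward graph i j) ≤ backDegree (toℕ j)
  new-edges j = at j
    where
    none : sum {4 + k} (λ _ → 0) ≡ 0
    none = ≡-trans (sum-const (4 + k) 0) (*-zeroʳ (4 + k))
    at : ∀ (j : Fin N) → sum (λ i → forward graph i j) ≤ backDegree (toℕ j)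
    at 0F = ≤-reflexive none
    at 1F = ≤-reflexive (cong (1 +_) none)
    at 2F = ≤-reflexive (cong (1 +_) none)
    at 3F = ≤-reflexive (cong (2 +_) none)
    at 4F = ≤-reflexive (cong (3 +_) none)
    at 5F = ≤-reflexive (cong (1 +_) none)
    at 6F = ≤-reflexive (cong (2 +_) none)
    at 7F = ≤-reflexive (cong (1 +_) none)
    at 8F = ≤-reflexive (cong (2 +_) none)
    at 9F = ≤-reflexive (cong (1 +_) none)
    at (suc 9F) = ≤-reflexive (cong (2 +_) none)
    -- Two pages are never joined, so only the vertices 0 and 1 contribute.
    at (suc (suc (suc (suc (suc (suc (suc (suc (suc (suc (suc j))))))))))) =
      ≤-reflexive (cong (2 +_) (sum-zero {4 + k} λ i → cong 𝟙 (Bool.∧-zeroʳ (toℕ i <ᵇ toℕ j))))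

  edges : numEdges graph ≤ 2 * N ∸ 6
  edges = begin
    numEdges graph                              ≡⟨ numEdges≡sum graph ⟩
    sum (λ i → sum (forward graph i))           ≡⟨ ∑-comm (forward graph) ⟩
    sum (λ j → sum (λ i → forward graph i j))   ≤⟨ sum-mono-≤ new-edges ⟩
    -- The eleven vertices before the pages contribute 16 edges, and each of the `4 + k` pages adds
    -- 2.
    sum {N} (λ j → backDegree (toℕ j))          ≡⟨ cong (16 +_) (sum-const (4 + k) 2) ⟩
    16 + (4 + k) * 2                            ≡⟨ m+n∸n≡m (16 + (4 + k) * 2) 6 ⟨
    16 + (4 + k) * 2 + 6 ∸ 6                    ≡⟨ cong (_∸ 6) (count k) ⟩
    2 * N ∸ 6                                   ∎
    where
    open ≤-Reasoning
    count : ∀ k → 16 + (4 + k) * 2 + 6 ≡ 2 * (15 + k)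
    count = solve-∀

  upper-bound : RsatAtMost N (cycleAdj 5) (2 * N ∸ 6)
  upper-bound = graph , colouring , saturated , edges

two-others : ∀ {n} → 3 ≤ n → ∀ (u : Fin n) → ∃ λ a → ∃ λ b → u ≢ a × u ≢ b × a ≢ b
two-others (s≤s (s≤s (s≤s _))) 0F            = 1F , 2F , (λ ()) , (λ ()) , λ ()
two-others (s≤s (s≤s (s≤s _))) 1F            = 0F , 2F , (λ ()) , (λ ()) , λ ()
two-others (s≤s (s≤s (s≤s _))) (suc (suc _)) = 0F , 1F , (λ ()) , (λ ()) , λ ()

-- The lower bound is stated with denominators cleared. As `2 * n` is at least 30, the truncated
-- subtraction is the ordinary one.
theorem1p2 : ∀ (n : ℕ) → 15 ≤ n
    → RsatLowerBound n (cycleAdj 5) (λ e → 3 * n ≤ 2 * e + 5)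
    × RsatAtMost n (cycleAdj 5) (2 * n ∸ 6)
theorem1p2 n 15≤n =
  (λ G c sat → Saturated.lower-bound G c sat (two-others (≤-trans (m≤m+n 3 12) 15≤n))) ,
  subst (λ n → RsatAtMost n (cycleAdj 5) (2 * n ∸ 6)) (m+[n∸m]≡n 15≤n) (Construction.upper-bound (n ∸ 15))
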